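{- Let $q$ be a prime power. Let $K^{\mathrm{Px}}:=\bigcup_{n\in\mathbb{N}}\mathbb{F}_{q}((t^{1/n}))$ and $\mathcal{O}^{\mathrm{Px}}:=\bigcup_{n\in\mathbb{N}}\mathbb{F}_{q}[[t^{1/n}]]$. Then $\mathcal{O}^{\mathrm{Px}}$ is $\exists$-$\emptyset$-definable in $K^{\mathrm{Px}}$.
   Context: $\mathbb{F}_{q}$ is the finite field with $q$ elements, and $(t^{1/n})_{n\in\mathbb{N}}$ (with $n\geq 1$) is a compatible system of $n$-th roots of $t$, i.e. $(t^{1/(mn)})^{m}=t^{1/n}$ for all $m,n\geq1$ and $t^{1/1}=t$. The field $K^{\mathrm{Px}}$ of Puiseux series over $\mathbb{F}_{q}$ is formally the direct limit of the fields $\mathbb{F}_{q}((t^{1/n}))$ along the natural inclusions (ordered by divisibility of $n$), and $\mathcal{O}^{\mathrm{Px}}$ is the valuation ring of the $t$-adic valuation on $K^{\mathrm{Px}}$ (whose value group is $\mathbb{Q}$). A subset of a field $L$ is $\exists$-$\emptyset$-definable if it is the set of elements of $L$ satisfying some existential first-order formula in one free variable in the language of rings $\mathcal{L}_{\mathrm{ring}}$, without parameters. -}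

module Defs where

open import Level using (Level; _⊔_)
open import Algebra.Apartness.Bundles using (HeytingField; HeytingCommutativeRing)
open import Algebra.Bundles using (CommutativeRing)
open import Algebra.Bundles.Raw using (RawRing)
open import Data.Bool.Base using (if_then_else_)
open import Data.Fin.Base using (Fin; toℕ)
open import Data.Fin.Properties using (≡-setoid)
open import Data.Integer.Base as ℤ using (ℤ; +_; -[1+_]; 0ℤ; ∣_∣; _%ℕ_; _/ℕ_)
open import Data.Integer.DivMod using ([n/ℕd]*d≤n)
import Data.Integer.Properties as ℤ
import Data.Integer.Tactic.RingSolver as ℤSolver
open import Data.Nat.Base as ℕ using (ℕ; zero; suc; NonZero; _≡ᵇ_)
import Data.Nat.Properties as ℕ
open import Data.Nat.Primality using (Prime)
open import Data.Product.Base using (Σ-syntax; ∃-syntax; _×_; _,_)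
open import Data.Sum.Base using (_⊎_)
open import Data.Vec.Base using (Vec; []; _∷_; _++_; lookup)
open import Function.Bundles using (Inverse; _⇔_)
open import Relation.Binary.Bundles using (Setoid)
open import Relation.Binary.PropositionalEquality.Core as ≡ using (_≡_)
open import Relation.Nullary.Negation.Core using (¬_)
open import Relation.Unary using (Pred)

private variable
  c ℓ ℓ₁ ℓ₂ p : Level

------------------------------------------------------------------------
-- Existential formulas in the language of rings

infix  8 ⊝_
infixl 7 _⊗_
infixl 6 _⊕_
infix  4 _≐_
infix  3 ¬′_
infixr 2 _∧′_
infixr 1 _∨′_

data Term (n : ℕ) : Set where
  var     : Fin n → Term n
  𝟎 𝟏     : Term n
  _⊕_ _⊗_ : Term n → Term n → Term n
  ⊝_      : Term n → Term n

data QFFormula (n : ℕ) : Set where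
  _≐_       : Term n → Term n → QFFormula n
  ¬′_       : QFFormula n → QFFormula n
  _∧′_ _∨′_ : QFFormula n → QFFormula n → QFFormula n

-- ∃ y₁ … yₘ . ψ(y₁,…,yₘ,x₁,…,xₙ) with ψ quantifier-free: in the matrix
-- the bound variables come first, then the n free ones.
record ∃Formula (n : ℕ) : Set where
  constructor ∃′
  field
    boundVars : ℕ
    matrix    : QFFormula (boundVars ℕ.+ n)

module Semantics (R : RawRing c ℓ) where
  open RawRing R

  ⟦_⟧ : ∀ {n} → Term n → Vec Carrier n → Carrier
  ⟦ var i ⟧ ρ = lookup ρ i
  ⟦ 𝟎     ⟧ ρ = 0#
  ⟦ 𝟏     ⟧ ρ = 1#
  ⟦ s ⊕ t ⟧ ρ = ⟦ s ⟧ ρ + ⟦ t ⟧ ρ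
  ⟦ s ⊗ t ⟧ ρ = ⟦ s ⟧ ρ * ⟦ t ⟧ ρ
  ⟦ ⊝ t   ⟧ ρ = - ⟦ t ⟧ ρ

  infix 0 _⊨qf_ _⊨_

  _⊨qf_ : ∀ {n} → Vec Carrier n → QFFormula n → Set ℓ
  ρ ⊨qf s ≐ t  = ⟦ s ⟧ ρ ≈ ⟦ t ⟧ ρ
  ρ ⊨qf ¬′ φ   = ¬ (ρ ⊨qf φ)
  ρ ⊨qf φ ∧′ ψ = (ρ ⊨qf φ) × (ρ ⊨qf ψ)
  ρ ⊨qf φ ∨′ ψ = (ρ ⊨qf φ) ⊎ (ρ ⊨qf ψ)

  _⊨_ : ∀ {n} → Vec Carrier n → ∃Formula n → Set (c ⊔ ℓ)
  ρ ⊨ ∃′ m ψ = Σ[ ys ∈ Vec Carrier m ] (ys ++ ρ ⊨qf ψ)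

∃-∅-Definable : (R : RawRing c ℓ) → Pred (RawRing.Carrier R) p → Set (c ⊔ ℓ ⊔ p)
∃-∅-Definable R P = Σ[ φ ∈ ∃Formula 1 ] (∀ x → P x ⇔ (x ∷ [] ⊨ φ))
  where open Semantics R

------------------------------------------------------------------------
-- Formal Laurent series and Puiseux series

module LaurentSeries (R : CommutativeRing c ℓ) where
  open CommutativeRing R
  open import Algebra.Properties.Ring ring using (-0#≈0#)
  open import Algebra.Properties.Monoid.Sum +-monoid
    using (sum⁺-syntax; sum-cong-≋; sum-replicate-zero)

  -- The series Σ coeff i · sⁱ; bound is some lower bound of its support,
  -- not necessarily the order.
  record Laurent : Set (c ⊔ ℓ) where
    field
      coeff    : ℤ → Carrier
      bound    : ℤ
      vanishes : ∀ i → i ℤ.< bound → coeff i ≈ 0#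

  open Laurent public

  infix  8 -ᴸ_
  infixl 7 _*ᴸ_
  infixl 6 _+ᴸ_
  infix  4 _≈ᴸ_

  _≈ᴸ_ : Laurent → Laurent → Set ℓ
  f ≈ᴸ g = ∀ i → coeff f i ≈ coeff g i

  IsPowerSeries : Laurent → Set ℓ
  IsPowerSeries f = ∀ i → i ℤ.< 0ℤ → coeff f i ≈ 0#

  0ᴸ : Laurent
  0ᴸ = record { coeff = λ _ → 0# ; bound = 0ℤ ; vanishes = λ _ _ → refl }

  1ᴸ : Laurent
  1ᴸ = record { coeff = δ ; bound = 0ℤ ; vanishes = δ-vanishes }
    where
    δ : ℤ → Carrier
    δ (+ zero)  = 1#
    δ (+ suc _) = 0#
    δ -[1+ _ ]  = 0#

    δ-vanishes : ∀ i → i ℤ.< 0ℤ → δ i ≈ 0#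
    δ-vanishes (+ _)    (ℤ.+<+ ())
    δ-vanishes -[1+ _ ] _ = refl

  _+ᴸ_ : Laurent → Laurent → Laurent
  f +ᴸ g = record
    { coeff    = λ i → coeff f i + coeff g i
    ; bound    = bound f ℤ.⊓ bound g
    ; vanishes = λ i i<b → trans
        (+-cong (vanishes f i (ℤ.<-≤-trans i<b (ℤ.i⊓j≤i (bound f) (bound g))))
                (vanishes g i (ℤ.<-≤-trans i<b (ℤ.i⊓j≤j (bound f) (bound g)))))
        (+-identityˡ 0#)
    }

  -ᴸ_ : Laurent → Laurent
  -ᴸ f = record
    { coeff    = λ i → - coeff f i
    ; bound    = bound f
    ; vanishes = λ i i<b → trans (-‿cong (vanishes f i i<b)) -0#≈0#
    }

  -- The coefficient of sⁱ is Σ f_k g_{i-k}; a term can be nonzero only for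
  -- bound f ≤ k ≤ i - bound g, so we sum over k = bound f + j with
  -- 0 ≤ j ≤ i - (bound f + bound g).  When that last number is negative, all
  -- terms vanish, and so does the finite sum over 0 ≤ j ≤ ∣ … ∣ used here.
  _*ᴸ_ : Laurent → Laurent → Laurent
  f *ᴸ g = record
    { coeff    = λ i → ∑[ j ≤ lastTerm i ] term i (toℕ j)
    ; bound    = bound f ℤ.+ bound g
    ; vanishes = λ i i<b → trans
        (sum-cong-≋ {suc (lastTerm i)} (λ j → term-vanishes i (toℕ j) i<b))
        (sum-replicate-zero (suc (lastTerm i)))
    }
    where
    lastTerm : ℤ → ℕ
    lastTerm i = ∣ i ℤ.- (bound f ℤ.+ bound g) ∣

    term : ℤ → ℕ → Carrier
    term i j = coeff f (bound f ℤ.+ + j) * coeff g (i ℤ.- (bound f ℤ.+ + j))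

    index< : ∀ a b i k → i ℤ.< a ℤ.+ b → i ℤ.- (a ℤ.+ + k) ℤ.< b
    index< a b i k i<a+b = ℤ.<-≤-trans
      (ℤ.+-monoˡ-< (ℤ.- (a ℤ.+ + k)) i<a+b)
      (≡.subst (ℤ._≤ b) (≡.sym (lemma a b (+ k))) (ℤ.i-j≤i b (+ k)))
      where
      lemma : ∀ a b k → (a ℤ.+ b) ℤ.- (a ℤ.+ k) ≡ b ℤ.- k
      lemma = ℤSolver.solve-∀

    term-vanishes : ∀ i j → i ℤ.< bound f ℤ.+ bound g → term i j ≈ 0#
    term-vanishes i j i<b =
      trans (*-congˡ (vanishes g _ (index< (bound f) (bound g) i j i<b))) (zeroʳ _)

  -- f(s) ↦ f(sᵃ).  For s = t^{1/n} and s′ = t^{1/(an)}, so that s = s′ᵃ, this is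
  -- the inclusion of R((t^{1/n})) into R((t^{1/(an)})).
  substPower : (a : ℕ) .{{_ : NonZero a}} → Laurent → Laurent
  substPower a f = record
    { coeff    = coeffᵃ
    ; bound    = bound f ℤ.* + a
    ; vanishes = vanishesᵃ
    }
    where
    coeffᵃ : ℤ → Carrier
    coeffᵃ i = if i %ℕ a ≡ᵇ 0 then coeff f (i /ℕ a) else 0#

    vanishesᵃ : ∀ i → i ℤ.< bound f ℤ.* + a → coeffᵃ i ≈ 0#
    vanishesᵃ i i<b with i %ℕ a
    ... | zero  = vanishes f _
      (ℤ.*-cancelʳ-<-nonNeg (+ a) (ℤ.≤-<-trans ([n/ℕd]*d≤n i a) i<b))
    ... | suc _ = refl

module PuiseuxSeries (R : CommutativeRing c ℓ) where
  open LaurentSeries R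

  -- An element of the disjoint union of the R((t^{1/n})), n ≥ 1: the Laurent
  -- series is in the variable t^{1/index}.
  record Puiseux : Set (c ⊔ ℓ) where
    constructor mkPuiseux
    field
      index            : ℕ
      .{{index-nonZero}} : NonZero index
      series           : Laurent

  open Puiseux public

  infix  8 -ᴾ_
  infixl 7 _*ᴾ_
  infixl 6 _+ᴾ_
  infix  4 _≈ᴾ_

  -- Equality in the direct limit: the images in some R((t^{1/N})) agree, where
  -- N is a common multiple of the two indices.
  record _≈ᴾ_ (x y : Puiseux) : Set ℓ where
    field
      a b             : ℕ
      .{{a-nonZero}}  : NonZero a
      .{{b-nonZero}}  : NonZero b
      commonIndex     : a ℕ.* index x ≡ b ℕ.* index y
      imagesAgree     : substPower a (series x) ≈ᴸ substPower b (series y)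

  liftOp₂ : (Laurent → Laurent → Laurent) → Puiseux → Puiseux → Puiseux
  liftOp₂ _∙_ (mkPuiseux m f) (mkPuiseux n g) =
    mkPuiseux (m ℕ.* n) {{ℕ.m*n≢0 m n}} (substPower n f ∙ substPower m g)

  _+ᴾ_ _*ᴾ_ : Puiseux → Puiseux → Puiseux
  _+ᴾ_ = liftOp₂ _+ᴸ_
  _*ᴾ_ = liftOp₂ _*ᴸ_

  -ᴾ_ : Puiseux → Puiseux
  -ᴾ mkPuiseux n f = mkPuiseux n (-ᴸ f)

  puiseuxRing : RawRing (c ⊔ ℓ) ℓ
  puiseuxRing = record
    { Carrier = Puiseux
    ; _≈_     = _≈ᴾ_
    ; _+_     = _+ᴾ_
    ; _*_     = _*ᴾ_
    ; -_      = -ᴾ_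
    ; 0#      = mkPuiseux 1 0ᴸ
    ; 1#      = mkPuiseux 1 1ᴸ
    }

  -- The union of the subrings R[[t^{1/n}]], n ≥ 1.
  InPowerSeriesUnion : Pred Puiseux (c ⊔ ℓ)
  InPowerSeriesUnion x = Σ[ y ∈ Puiseux ] IsPowerSeries (series y) × x ≈ᴾ y

------------------------------------------------------------------------
-- Finite fields

IsPrimePower : ℕ → Set
IsPrimePower q = ∃[ p ] ∃[ k ] Prime p × q ≡ p ℕ.^ suc k

HasCardinality : Setoid c ℓ → ℕ → Set (c ⊔ ℓ)
HasCardinality S q = Inverse S (≡-setoid q)

-- On a finite carrier equality and invertibility are decidable, so tightness of
-- the apartness says exactly that every nonzero element is invertible.
module _ (F : HeytingField c ℓ₁ ℓ₂) where
  private
    R : CommutativeRing c ℓ₁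
    R = HeytingCommutativeRing.commutativeRing (HeytingField.heytingCommutativeRing F)

  K^Px : RawRing (c ⊔ ℓ₁) ℓ₁
  K^Px = PuiseuxSeries.puiseuxRing R

  𝒪^Px : Pred (RawRing.Carrier K^Px) (c ⊔ ℓ₁)
  𝒪^Px = PuiseuxSeries.InPowerSeriesUnion R

{-# OPTIONS --safe #-}

-- Let e = 1 + q!, so that aᵉ = a on 𝔽q, and put w(x) = xᵉ − x and D(y) = 1 + y − yᵉ.
-- Then x is integral if and only if y = w(x) D(y) has a solution y.
-- If x is integral, then w(x) lies in the maximal ideal, so y ↦ w(x) D(y) is a
-- contraction of 𝔽q[[t^{1/n}]] and has a fixed point; no extension of the index
-- and no decision whether w(x) = 0 is needed.
-- Conversely, D has the constant value 1 on 𝔽q, hence y / D(y) is integral for every y: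
-- for y integral D(y) is a unit, and otherwise D(y) has order e·v(y) < v(y).
-- If v(x) < 0, then w(x) = y / D(y) would have order e·v(x) < 0.
module Submission where

open import Defs
open import Level using (Level; _⊔_)
open import Data.Nat.Base using (ℕ)
open import Algebra.Apartness.Bundles using (HeytingField; HeytingCommutativeRing)
open import Algebra.Bundles using (CommutativeRing)
open import Algebra.Bundles.Raw using (RawRing)
import Algebra.Definitions.RawSemiring as RawSemiringDefinitions
open import Data.Fin.Base using (zero; suc; toℕ)
import Data.Fin.Properties as Fin
open import Data.Integer.Base as ℤ using (ℤ; +_; -[1+_]; 0ℤ; ∣_∣; _%ℕ_; _/ℕ_)
open import Data.Integer.DivMod using (a≡a%ℕn+[a/ℕn]*n; n%ℕd<d)
import Data.Integer.Properties as ℤ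
import Data.Integer.Tactic.RingSolver as ℤSolver
open import Data.Nat.Base as ℕ using (zero; suc; NonZero; _!)
open import Data.Nat.Divisibility using (divides; m≤n⇒m!∣n!; m∣m*n; ∣-trans)
import Data.Nat.Properties as ℕ
import Data.Nat.Tactic.RingSolver as ℕSolver
open import Data.Product.Base using (Σ-syntax; ∃-syntax; _×_; _,_; proj₁; proj₂)
open import Data.Product.Function.NonDependent.Propositional using (_×-⇔_)
open import Data.Sum.Base using (_⊎_; inj₁; inj₂)
open import Data.Sum.Function.Propositional using (_⊎-⇔_)
open import Data.Vec.Base using (Vec; lookup; []; _∷_; _++_)
open import Function.Base using (_∘_)
open import Function.Bundles using (Inverse; Equivalence; _⇔_; mk⇔)
open import Function.Related.TypeIsomorphisms using (¬-cong-⇔)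
open import Relation.Binary.PropositionalEquality.Core as ≡ using (_≡_; _≢_)
open import Relation.Nullary.Decidable using (Dec; yes; no; map′)
open import Relation.Nullary.Negation.Core using (¬_; contradiction)

private variable
  c ℓ ℓ₁ ℓ₂ : Level

-- The formula cannot mention t, and the divisible value group ℚ offers no congruence condition on
-- orders. What separates the two cases is the residue field: w sends integral elements into the
-- maximal ideal and multiplies negative orders by e. Of e the argument asks that aᵉ = a on 𝔽q and e
-- > 1. The constant q! arises because every nonzero a has, by the pigeonhole principle, a
-- multiplicative order of at most q. Equality of series is not decidable, so the order of an
-- arbitrary series cannot be computed. But only finitely many coefficients lie between a recorded
-- bound and degree 0, so a series can be classified as integral or of a definite negative order.
-- The converse forms no quotient: it compares y with w(x) D(y) in the degree where the latter has
-- its leading coefficient. Two features of the encoding shape the rest. Coefficients of products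
-- are computed from recorded bounds, which equality ignores, so products are handled through freely
-- chosen summation windows. And an element of the direct limit has representatives at many indices,
-- so quantifier-free formulas are moved into a single 𝔽q((t^{1/M})).

-- Integer inequalities and divisibility of exponents

i<b+c⇒i-k<c : ∀ {i b c k} → i ℤ.< b ℤ.+ c → b ℤ.≤ k → i ℤ.- k ℤ.< c
i<b+c⇒i-k<c {i} {b} {c} {k} i<b+c b≤k = begin-strict
  i ℤ.- k           ≤⟨ ℤ.+-monoʳ-≤ i (ℤ.neg-mono-≤ b≤k) ⟩
  i ℤ.- b           <⟨ ℤ.+-monoˡ-< (ℤ.- b) i<b+c ⟩
  b ℤ.+ c ℤ.- b     ≡⟨ cancel b c ⟩
  c                 ∎
  where
  open ℤ.≤-Reasoning
  cancel : ∀ b c → b ℤ.+ c ℤ.- b ≡ c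
  cancel = ℤSolver.solve-∀

i≤∣i∣ : ∀ i → i ℤ.≤ + ∣ i ∣
i≤∣i∣ (+ n)    = ℤ.≤-refl
i≤∣i∣ -[1+ n ] = ℤ.-≤+

-- Otherwise `r` would be |k - b| a, which is 0 or at least `a`.
0<r<a⇒ba+r≢ka : ∀ {a r} b k → 0 ℕ.< r → r ℕ.< a → b ℤ.* + a ℤ.+ + r ≢ k ℤ.* + a
0<r<a⇒ba+r≢ka {a} {r} b k 0<r r<a eq = helper ∣ k ℤ.- b ∣ r≡na
  where
  shift : ∀ a r b k → b ℤ.* a ℤ.+ r ≡ k ℤ.* a → r ≡ (k ℤ.- b) ℤ.* a
  shift a r b k eq = ≡.trans (lhs a r b) (≡.trans (≡.cong (λ m → m ℤ.- b ℤ.* a) eq) (rhs a b k))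
    where
    lhs : ∀ a r b → r ≡ b ℤ.* a ℤ.+ r ℤ.- b ℤ.* a
    lhs = ℤSolver.solve-∀
    rhs : ∀ a b k → k ℤ.* a ℤ.- b ℤ.* a ≡ (k ℤ.- b) ℤ.* a
    rhs = ℤSolver.solve-∀
  r≡na : r ≡ ∣ k ℤ.- b ∣ ℕ.* a
  r≡na = ≡.trans (≡.cong ∣_∣ (shift (+ a) (+ r) b k eq)) (ℤ.abs-* (k ℤ.- b) (+ a))
  helper : ∀ n → r ≢ n ℕ.* a
  helper zero    r≡0    = ℕ.<⇒≢ 0<r (≡.sym r≡0)
  helper (suc n) r≡a+na = ℕ.<⇒≱ r<a (≡.subst (a ℕ.≤_) (≡.sym r≡a+na) (ℕ.m≤m+n a _))

-- This view replaces the remainder test inside `substPower` by an explicit quotient or by a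
-- refutation.
data MultipleOf (a : ℕ) (i : ℤ) : Set where
  multiple    : ∀ k → i ≡ k ℤ.* + a → MultipleOf a i
  nonMultiple : (∀ k → i ≢ k ℤ.* + a) → MultipleOf a i

multipleOf? : ∀ a .{{_ : NonZero a}} i → MultipleOf a i
multipleOf? a i with i %ℕ a | a≡a%ℕn+[a/ℕn]*n i a | n%ℕd<d i a
... | zero  | i≡r+ka | _   = multiple (i /ℕ a) (≡.trans i≡r+ka (ℤ.+-identityˡ _))
... | suc r | i≡r+ka | r<a = nonMultiple λ k i≡ka → 0<r<a⇒ba+r≢ka (i /ℕ a) k ℕ.z<s r<a
  (≡.trans (ℤ.+-comm (i /ℕ a ℤ.* + a) (+ suc r)) (≡.trans (≡.sym i≡r+ka) i≡ka))

-- Coefficients of products as sums over windows of ℤ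

module LaurentProperties (R : CommutativeRing c ℓ) where
  open CommutativeRing R
  open LaurentSeries R
  open import Algebra.Properties.Monoid.Sum +-monoid using (sum; sum-cong-≗)
  open import Relation.Binary.Reasoning.Setoid setoid

  -- Unlike the `Fin`-indexed sum in `_*ᴸ_`, a window of ℤ can be split or shifted without
  -- reindexing the summand.
  sumFrom : ℤ → ℕ → (ℤ → Carrier) → Carrier
  sumFrom a zero    T = 0#
  sumFrom a (suc n) T = T a + sumFrom (ℤ.suc a) n T

  sumFrom-cong : ∀ {T U} → (∀ i → T i ≈ U i) → ∀ a n → sumFrom a n T ≈ sumFrom a n U
  sumFrom-cong T≈U a zero    = refl
  sumFrom-cong T≈U a (suc n) = +-cong (T≈U a) (sumFrom-cong T≈U (ℤ.suc a) n)

  suc+≡+suc : ∀ a n → ℤ.suc a ℤ.+ + n ≡ a ℤ.+ + suc n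
  suc+≡+suc a n = shift a (+ n)
    where
    shift : ∀ a n → (+ 1 ℤ.+ a) ℤ.+ n ≡ a ℤ.+ (+ 1 ℤ.+ n)
    shift = ℤSolver.solve-∀

  sum≡sumFrom : ∀ (T : ℤ → Carrier) a n → sum {n} (λ j → T (a ℤ.+ + toℕ j)) ≡ sumFrom a n T
  sum≡sumFrom T a zero    = ≡.refl
  sum≡sumFrom T a (suc n) = ≡.cong₂ _+_ (≡.cong T (ℤ.+-identityʳ a))
    (≡.trans (sum-cong-≗ {n} (λ j → ≡.cong T (≡.sym (suc+≡+suc a (toℕ j)))))
             (sum≡sumFrom T (ℤ.suc a) n))

  sumFrom-zero : ∀ {T} a n → (∀ j → j ℕ.< n → T (a ℤ.+ + j) ≈ 0#) → sumFrom a n T ≈ 0#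
  sumFrom-zero a zero    T≈0 = refl
  sumFrom-zero {T} a (suc n) T≈0 = trans
    (+-cong (≡.subst (λ i → T i ≈ 0#) (ℤ.+-identityʳ a) (T≈0 0 ℕ.z<s))
            (sumFrom-zero (ℤ.suc a) n (λ j j<n →
              ≡.subst (λ i → T i ≈ 0#) (≡.sym (suc+≡+suc a j)) (T≈0 (suc j) (ℕ.s<s j<n)))))
    (+-identityˡ 0#)

  sumFrom-+ : ∀ T a m n → sumFrom a (m ℕ.+ n) T ≈ sumFrom a m T + sumFrom (a ℤ.+ + m) n T
  sumFrom-+ T a zero n = begin
    sumFrom a n T                  ≡⟨ ≡.cong (λ a → sumFrom a n T) (ℤ.+-identityʳ a) ⟨
    sumFrom (a ℤ.+ 0ℤ) n T         ≈⟨ +-identityˡ _ ⟨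
    0# + sumFrom (a ℤ.+ 0ℤ) n T    ∎
  sumFrom-+ T a (suc m) n = begin
    T a + sumFrom (ℤ.suc a) (m ℕ.+ n) T
      ≈⟨ +-congˡ (sumFrom-+ T (ℤ.suc a) m n) ⟩
    T a + (sumFrom (ℤ.suc a) m T + sumFrom (ℤ.suc a ℤ.+ + m) n T)
      ≈⟨ +-assoc _ _ _ ⟨
    sumFrom a (suc m) T + sumFrom (ℤ.suc a ℤ.+ + m) n T
      ≡⟨ ≡.cong (λ b → sumFrom a (suc m) T + sumFrom b n T) (suc+≡+suc a m) ⟩
    sumFrom a (suc m) T + sumFrom (a ℤ.+ + suc m) n T ∎

  -- The window is half-open and may be empty: `n` = 0 makes `T` vanish everywhere.
  SupportedIn : ℤ → ℕ → (ℤ → Carrier) → Set ℓ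
  SupportedIn a n T = (∀ k → k ℤ.< a → T k ≈ 0#) × (∀ k → a ℤ.+ + n ℤ.≤ k → T k ≈ 0#)

  sumFrom-extend : ∀ {a n T} → SupportedIn a n T → ∀ p r →
    sumFrom (a ℤ.- + p) (p ℕ.+ (n ℕ.+ r)) T ≈ sumFrom a n T
  sumFrom-extend {a} {n} {T} (below , above) p r = begin
    sumFrom a-p (p ℕ.+ (n ℕ.+ r)) T
      ≈⟨ sumFrom-+ T a-p p (n ℕ.+ r) ⟩
    sumFrom a-p p T + sumFrom (a-p ℤ.+ + p) (n ℕ.+ r) T
      ≈⟨ +-cong (sumFrom-zero a-p p λ j j<p → below _ (a-p+j<a j j<p))
                (reflexive (≡.cong (λ b → sumFrom b (n ℕ.+ r) T) (cancel a (+ p)))) ⟩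
    0# + sumFrom a (n ℕ.+ r) T
      ≈⟨ +-identityˡ _ ⟩
    sumFrom a (n ℕ.+ r) T
      ≈⟨ sumFrom-+ T a n r ⟩
    sumFrom a n T + sumFrom (a ℤ.+ + n) r T
      ≈⟨ +-congˡ (sumFrom-zero (a ℤ.+ + n) r λ j _ → above _ (ℤ.i≤i+j _ (+ j))) ⟩
    sumFrom a n T + 0#
      ≈⟨ +-identityʳ _ ⟩
    sumFrom a n T ∎
    where
    a-p = a ℤ.- + p
    cancel : ∀ a p → a ℤ.- p ℤ.+ p ≡ a
    cancel = ℤSolver.solve-∀
    a-p+j<a : ∀ j → j ℕ.< p → a-p ℤ.+ + j ℤ.< a
    a-p+j<a j j<p = ≡.subst (a-p ℤ.+ + j ℤ.<_) (cancel a (+ p)) (ℤ.+-monoʳ-< a-p (ℤ.+<+ j<p))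

  -- Both windows extend to the common window from a ⊓ a′ to (a + n) ⊔ (a′ + n′).
  sumFrom-unique : ∀ {a n a′ n′ T} → SupportedIn a n T → SupportedIn a′ n′ T →
    sumFrom a n T ≈ sumFrom a′ n′ T
  sumFrom-unique {a} {n} {a′} {n′} {T} s s′ = begin
    sumFrom a n T                                 ≈⟨ sumFrom-extend s (gap a) (end a n) ⟨
    sumFrom (a ℤ.- + gap a) (gap a ℕ.+ (n ℕ.+ end a n)) T
      ≡⟨ ≡.cong₂ (λ b m → sumFrom b m T) (≡.trans (start≡ a lo≤a) (≡.sym (start≡ a′ lo≤a′)))
           (ℤ.+-injective (≡.trans (length≡ a n lo≤a a+n≤hi) (≡.sym (length≡ a′ n′ lo≤a′ a′+n′≤hi)))) ⟩
    sumFrom (a′ ℤ.- + gap a′) (gap a′ ℕ.+ (n′ ℕ.+ end a′ n′)) T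
                                                  ≈⟨ sumFrom-extend s′ (gap a′) (end a′ n′) ⟩
    sumFrom a′ n′ T                               ∎
    where
    lo = a ℤ.⊓ a′
    hi = (a ℤ.+ + n) ℤ.⊔ (a′ ℤ.+ + n′)
    lo≤a = ℤ.i⊓j≤i a a′
    lo≤a′ = ℤ.i⊓j≤j a a′
    a+n≤hi = ℤ.i≤i⊔j (a ℤ.+ + n) (a′ ℤ.+ + n′)
    a′+n′≤hi = ℤ.i≤j⊔i (a ℤ.+ + n) (a′ ℤ.+ + n′)
    gap : ℤ → ℕ
    gap b = ∣ b ℤ.- lo ∣
    end : ℤ → ℕ → ℕ
    end b m = ∣ hi ℤ.- (b ℤ.+ + m) ∣
    +∣j-i∣ : ∀ {i j} → i ℤ.≤ j → + ∣ j ℤ.- i ∣ ≡ j ℤ.- i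
    +∣j-i∣ i≤j = ℤ.0≤i⇒+∣i∣≡i (ℤ.i≤j⇒0≤j-i i≤j)
    start≡ : ∀ b → lo ℤ.≤ b → b ℤ.- + gap b ≡ lo
    start≡ b lo≤b = ≡.trans (≡.cong (λ m → b ℤ.- m) (+∣j-i∣ lo≤b)) (cancel b lo)
      where
      cancel : ∀ b l → b ℤ.- (b ℤ.- l) ≡ l
      cancel = ℤSolver.solve-∀
    length≡ : ∀ b m → lo ℤ.≤ b → b ℤ.+ + m ℤ.≤ hi → + (gap b ℕ.+ (m ℕ.+ end b m)) ≡ hi ℤ.- lo
    length≡ b m lo≤b b+m≤hi = ≡.trans
      (≡.cong₂ (λ g e → g ℤ.+ (+ m ℤ.+ e)) (+∣j-i∣ lo≤b) (+∣j-i∣ b+m≤hi)) (telescope b (+ m) lo hi)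
      where
      telescope : ∀ b m l h → b ℤ.- l ℤ.+ (m ℤ.+ (h ℤ.- (b ℤ.+ m))) ≡ h ℤ.- l
      telescope = ℤSolver.solve-∀

  -- Each block of `a` consecutive integers that starts at a multiple of `a` contains no other one.
  -- The window runs from b a to (b + n) a with both ends included, hence the extra `suc` on either
  -- side.
  sumFrom-multiples : ∀ a .{{_ : NonZero a}} {T} → (∀ i → (∀ k → i ≢ k ℤ.* + a) → T i ≈ 0#) →
    ∀ b n → sumFrom (b ℤ.* + a) (suc (n ℕ.* a)) T ≈ sumFrom b (suc n) (λ k → T (k ℤ.* + a))
  sumFrom-multiples a T≈0 b zero = refl
  sumFrom-multiples a@(suc a′) {T} T≈0 b (suc n) = +-congˡ (begin
    sumFrom b′ (a ℕ.+ n ℕ.* a) T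
      ≡⟨ ≡.cong (λ m → sumFrom b′ m T) (ℕ.+-suc a′ (n ℕ.* a)) ⟨
    sumFrom b′ (a′ ℕ.+ suc (n ℕ.* a)) T
      ≈⟨ sumFrom-+ T b′ a′ (suc (n ℕ.* a)) ⟩
    sumFrom b′ a′ T + sumFrom (b′ ℤ.+ + a′) (suc (n ℕ.* a)) T
      ≈⟨ +-cong (sumFrom-zero b′ a′ λ j j<a′ → T≈0 _ λ k eq → 0<r<a⇒ba+r≢ka b k ℕ.z<s (ℕ.s<s j<a′)
                  (≡.trans (≡.sym (suc+≡+suc (b ℤ.* + a) j)) eq))
                (reflexive (≡.cong (λ d → sumFrom d (suc (n ℕ.* a)) T) next)) ⟩
    0# + sumFrom (ℤ.suc b ℤ.* + a) (suc (n ℕ.* a)) T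
      ≈⟨ +-identityˡ _ ⟩
    sumFrom (ℤ.suc b ℤ.* + a) (suc (n ℕ.* a)) T
      ≈⟨ sumFrom-multiples a T≈0 (ℤ.suc b) n ⟩
    sumFrom (ℤ.suc b) (suc n) (λ k → T (k ℤ.* + a)) ∎)
    where
    b′ = ℤ.suc (b ℤ.* + a)
    next : b′ ℤ.+ + a′ ≡ ℤ.suc b ℤ.* + a
    next = ≡.trans (suc+≡+suc (b ℤ.* + a) a′) (≡.trans (ℤ.+-comm (b ℤ.* + a) (+ a)) (≡.sym (ℤ.suc-* b (+ a))))

  term : Laurent → Laurent → ℤ → ℤ → Carrier
  term f g i k = coeff f k * coeff g (i ℤ.- k)

  -- This is v(f) ≥ b for an arbitrary `b`, of which the recorded `bound f` is one instance.
  record VanishesBelow (f : Laurent) (b : ℤ) : Set ℓ where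
    constructor vanishingBelow
    field
      coeff≈0 : ∀ i → i ℤ.< b → coeff f i ≈ 0#

  open VanishesBelow

  vanishesBelow-bound : ∀ f → VanishesBelow f (bound f)
  vanishesBelow-bound f = vanishingBelow (vanishes f)

  term-zeroˡ : ∀ {f b} g i → VanishesBelow f b → ∀ k → k ℤ.< b → term f g i k ≈ 0#
  term-zeroˡ g i vf k k<b = trans (*-congʳ (coeff≈0 vf k k<b)) (zeroˡ _)

  term-zeroʳ : ∀ f {g c} i → VanishesBelow g c → ∀ k → i ℤ.- k ℤ.< c → term f g i k ≈ 0#
  term-zeroʳ f i vg k i-k<c = trans (*-congˡ (coeff≈0 vg _ i-k<c)) (zeroʳ _)

  productLength : Laurent → Laurent → ℤ → ℕ
  productLength f g i = suc ∣ i ℤ.- (bound f ℤ.+ bound g) ∣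

  coeff-*-sumFrom : ∀ f g i →
    coeff (f *ᴸ g) i ≡ sumFrom (bound f) (productLength f g i) (term f g i)
  coeff-*-sumFrom f g i = sum≡sumFrom (term f g i) (bound f) (productLength f g i)

  -- Below `bound f` the left factor vanishes, beyond the window the right one. The absolute value
  -- in `productLength` is safe because it is at least i - (bound f + bound g).
  term-supported : ∀ f g i → SupportedIn (bound f) (productLength f g i) (term f g i)
  term-supported f g i = term-zeroˡ g i (vanishesBelow-bound f) , λ k b+n≤k → term-zeroʳ f i (vanishesBelow-bound g) k
    (i<b+c⇒i-k<c (i<end (bound f) (bound g)) b+n≤k)
    where
    i<end : ∀ b c → i ℤ.< b ℤ.+ + suc ∣ i ℤ.- (b ℤ.+ c) ∣ ℤ.+ c
    i<end b c = ≡.subst₂ ℤ._<_ (lhs b c i) (rhs b c (+ suc ∣ i ℤ.- (b ℤ.+ c) ∣))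
      (ℤ.+-monoʳ-< (b ℤ.+ c) (ℤ.≤-<-trans (i≤∣i∣ _) (ℤ.+<+ (ℕ.n<1+n _))))
      where
      lhs : ∀ b c i → b ℤ.+ c ℤ.+ (i ℤ.- (b ℤ.+ c)) ≡ i
      lhs = ℤSolver.solve-∀
      rhs : ∀ b c n → b ℤ.+ c ℤ.+ n ≡ b ℤ.+ n ℤ.+ c
      rhs = ℤSolver.solve-∀

  -- This frees the coefficient from the recorded bounds: any window containing the support computes
  -- it, so later proofs pick a convenient one.
  coeff-* : ∀ f g i {a n} → SupportedIn a n (term f g i) →
    coeff (f *ᴸ g) i ≈ sumFrom a n (term f g i)
  coeff-* f g i s = trans (reflexive (coeff-*-sumFrom f g i)) (sumFrom-unique (term-supported f g i) s)

  -- Termwise equality makes the window of the primed product valid for the unprimed one as well,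
  -- whatever their bounds.
  coeff-*-cong : ∀ f g f′ g′ i → (∀ k → term f g i k ≈ term f′ g′ i k) →
    coeff (f *ᴸ g) i ≈ coeff (f′ *ᴸ g′) i
  coeff-*-cong f g f′ g′ i T≈T′ with below , above ← term-supported f′ g′ i = begin
    coeff (f *ᴸ g) i
      ≈⟨ coeff-* f g i ((λ k k<a → trans (T≈T′ k) (below k k<a)) , (λ k a≤k → trans (T≈T′ k) (above k a≤k))) ⟩
    sumFrom (bound f′) (productLength f′ g′ i) (term f g i)
      ≈⟨ sumFrom-cong T≈T′ (bound f′) (productLength f′ g′ i) ⟩
    sumFrom (bound f′) (productLength f′ g′ i) (term f′ g′ i)
      ≡⟨ coeff-*-sumFrom f′ g′ i ⟨
    coeff (f′ *ᴸ g′) i ∎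

  *ᴸ-cong : ∀ f f′ g g′ → f ≈ᴸ f′ → g ≈ᴸ g′ → f *ᴸ g ≈ᴸ f′ *ᴸ g′
  *ᴸ-cong f f′ g g′ f≈f′ g≈g′ i =
    coeff-*-cong f g f′ g′ i (λ k → *-cong (f≈f′ k) (g≈g′ (i ℤ.- k)))

  *-vanishes : ∀ f g {b c} → VanishesBelow f b → VanishesBelow g c →
    VanishesBelow (f *ᴸ g) (b ℤ.+ c)
  -- The empty window at `b` works: when i < b + c, every k satisfies k < b or i - k < c.
  *-vanishes f g {b} {c} vf vg = vanishingBelow λ i i<b+c → coeff-* f g i {b} {0} (term-zeroˡ g i vf , λ k b≤k →
    term-zeroʳ f i vg k (i<b+c⇒i-k<c i<b+c (≡.subst (ℤ._≤ k) (ℤ.+-identityʳ b) b≤k)))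

  -- In degree b + c only the term k = b survives, so a window of length one suffices.
  coeff-*-lead : ∀ f g {b c} → VanishesBelow f b → VanishesBelow g c →
    coeff (f *ᴸ g) (b ℤ.+ c) ≈ coeff f b * coeff g c
  coeff-*-lead f g {b} {c} vf vg = begin
    coeff (f *ᴸ g) i
      ≈⟨ coeff-* f g i {b} {1} (term-zeroˡ g i vf , λ k 1+b≤k → term-zeroʳ f i vg k
           (i<b+c⇒i-k<c (ℤ.+-monoˡ-< c (b<b+1 b)) 1+b≤k)) ⟩
    term f g i b + 0#
      ≈⟨ +-identityʳ _ ⟩
    coeff f b * coeff g (i ℤ.- b)
      ≡⟨ ≡.cong (λ j → coeff f b * coeff g j) (cancel b c) ⟩
    coeff f b * coeff g c ∎
    where
    i = b ℤ.+ c
    cancel : ∀ b c → b ℤ.+ c ℤ.- b ≡ c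
    cancel = ℤSolver.solve-∀
    b<b+1 : ∀ b → b ℤ.< b ℤ.+ + 1
    b<b+1 b = ≡.subst (ℤ._< b ℤ.+ + 1) (ℤ.+-identityʳ b) (ℤ.+-monoʳ-< b (ℤ.+<+ ℕ.z<s))

-- The substitution s ↦ sᵃ is injective and respects the operations

module SubstPowerProperties (R : CommutativeRing c ℓ) where
  open CommutativeRing R
  open LaurentSeries R
  open LaurentProperties R
  open import Algebra.Properties.Ring ring using (-0#≈0#)
  open import Relation.Binary.Reasoning.Setoid setoid

  coeff-substPower-multiple : ∀ a .{{_ : NonZero a}} f k →
    coeff (substPower a f) (k ℤ.* + a) ≈ coeff f k
  coeff-substPower-multiple a f k with (k ℤ.* + a) %ℕ a | a≡a%ℕn+[a/ℕn]*n (k ℤ.* + a) a | n%ℕd<d (k ℤ.* + a) a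
  ... | zero  | ka≡qa   | _   = reflexive (≡.cong (coeff f)
    (≡.sym (ℤ.*-cancelʳ-≡ k _ (+ a) (≡.trans ka≡qa (ℤ.+-identityˡ _)))))
  ... | suc r | ka≡r+qa | r<a = contradiction
    (≡.sym (≡.trans ka≡r+qa (ℤ.+-comm (+ suc r) ((k ℤ.* + a) /ℕ a ℤ.* + a))))
    (0<r<a⇒ba+r≢ka ((k ℤ.* + a) /ℕ a) k ℕ.z<s r<a)

  coeff-substPower-nonMultiple : ∀ a .{{_ : NonZero a}} f i → (∀ k → i ≢ k ℤ.* + a) →
    coeff (substPower a f) i ≈ 0#
  coeff-substPower-nonMultiple a f i i≢ka with i %ℕ a | a≡a%ℕn+[a/ℕn]*n i a
  ... | zero  | i≡qa = contradiction (≡.trans i≡qa (ℤ.+-identityˡ _)) (i≢ka (i /ℕ a))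
  ... | suc _ | _    = refl

  substPower-cong : ∀ a .{{_ : NonZero a}} f g → f ≈ᴸ g → substPower a f ≈ᴸ substPower a g
  substPower-cong a f g f≈g i with i %ℕ a
  ... | zero  = f≈g (i /ℕ a)
  ... | suc _ = refl

  substPower-injective : ∀ a .{{_ : NonZero a}} f g → substPower a f ≈ᴸ substPower a g → f ≈ᴸ g
  substPower-injective a f g σf≈σg k = begin
    coeff f k                            ≈⟨ coeff-substPower-multiple a f k ⟨
    coeff (substPower a f) (k ℤ.* + a)   ≈⟨ σf≈σg (k ℤ.* + a) ⟩
    coeff (substPower a g) (k ℤ.* + a)   ≈⟨ coeff-substPower-multiple a g k ⟩
    coeff g k                            ∎

  -- The composite exponent enters as `d` with an equation, so that two factorizations of the same
  -- number can be compared.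
  substPower-∘ : ∀ a b d .{{_ : NonZero a}} .{{_ : NonZero b}} .{{_ : NonZero d}} f → d ≡ b ℕ.* a →
    substPower a (substPower b f) ≈ᴸ substPower d f
  substPower-∘ a b d f ≡.refl i with multipleOf? d i
  ... | multiple k ≡.refl = begin
    coeff (substPower a (substPower b f)) (k ℤ.* + (b ℕ.* a))
      ≡⟨ ≡.cong (coeff (substPower a (substPower b f))) (assoc k) ⟩
    coeff (substPower a (substPower b f)) (k ℤ.* + b ℤ.* + a)
      ≈⟨ coeff-substPower-multiple a (substPower b f) (k ℤ.* + b) ⟩
    coeff (substPower b f) (k ℤ.* + b)
      ≈⟨ coeff-substPower-multiple b f k ⟩
    coeff f k
      ≈⟨ coeff-substPower-multiple d f k ⟨
    coeff (substPower d f) (k ℤ.* + d) ∎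
    where
    assoc : ∀ k → k ℤ.* + (b ℕ.* a) ≡ k ℤ.* + b ℤ.* + a
    assoc k = ≡.trans (≡.cong (k ℤ.*_) (ℤ.pos-* b a)) (≡.sym (ℤ.*-assoc k (+ b) (+ a)))
  ... | nonMultiple i≢kd = trans lhs≈0 (sym (coeff-substPower-nonMultiple d f i i≢kd))
    where
    lhs≈0 : coeff (substPower a (substPower b f)) i ≈ 0#
    lhs≈0 with multipleOf? a i
    ... | nonMultiple i≢ka = coeff-substPower-nonMultiple a (substPower b f) i i≢ka
    ... | multiple k ≡.refl = trans (coeff-substPower-multiple a (substPower b f) k)
      (coeff-substPower-nonMultiple b f k λ l k≡lb → i≢kd l
        (≡.trans (≡.cong (ℤ._* + a) k≡lb)
          (≡.trans (ℤ.*-assoc l (+ b) (+ a)) (≡.cong (l ℤ.*_) (≡.sym (ℤ.pos-* b a))))))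

  substPower-1ᴸ : ∀ a .{{_ : NonZero a}} → substPower a 1ᴸ ≈ᴸ 1ᴸ
  substPower-1ᴸ a i with multipleOf? a i
  ... | multiple k ≡.refl = trans (coeff-substPower-multiple a 1ᴸ k) (δ-multiple a k)
    where
    δ-multiple : ∀ a .{{_ : NonZero a}} k → coeff 1ᴸ k ≈ coeff 1ᴸ (k ℤ.* + a)
    δ-multiple (suc _) (+ zero)  = refl
    δ-multiple (suc _) (+ suc _) = refl
    δ-multiple (suc _) -[1+ _ ]  = refl
  ... | nonMultiple i≢ka = trans (coeff-substPower-nonMultiple a 1ᴸ i i≢ka) (sym (δ-nonzero i i≢ka))
    where
    δ-nonzero : ∀ i → (∀ k → i ≢ k ℤ.* + a) → coeff 1ᴸ i ≈ 0#
    δ-nonzero (+ zero)  i≢ka = contradiction ≡.refl (i≢ka 0ℤ)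
    δ-nonzero (+ suc _) i≢ka = refl
    δ-nonzero -[1+ _ ]  i≢ka = refl

  substPower-0ᴸ : ∀ a .{{_ : NonZero a}} → substPower a 0ᴸ ≈ᴸ 0ᴸ
  substPower-0ᴸ a i with i %ℕ a
  ... | zero  = refl
  ... | suc _ = refl

  substPower-+ : ∀ a .{{_ : NonZero a}} f g → substPower a (f +ᴸ g) ≈ᴸ substPower a f +ᴸ substPower a g
  substPower-+ a f g i with i %ℕ a
  ... | zero  = refl
  ... | suc _ = sym (+-identityˡ 0#)

  substPower-neg : ∀ a .{{_ : NonZero a}} f → substPower a (-ᴸ f) ≈ᴸ -ᴸ substPower a f
  substPower-neg a f i with i %ℕ a
  ... | zero  = refl
  ... | suc _ = sym -0#≈0#

  private
    minus-multiple : ∀ i j k l → i ℤ.- k ≡ l → k ≡ j → i ≡ l ℤ.+ j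
    minus-multiple i j .j .(i ℤ.- j) ≡.refl ≡.refl = cancel i j
      where
      cancel : ∀ i j → i ≡ i ℤ.- j ℤ.+ j
      cancel = ℤSolver.solve-∀

    distribʳ-- : ∀ k l a → k ℤ.* a ℤ.- l ℤ.* a ≡ (k ℤ.- l) ℤ.* a
    distribʳ-- = ℤSolver.solve-∀

  term-nonMultiple : ∀ a .{{_ : NonZero a}} f g k j → (∀ l → j ≢ l ℤ.* + a) →
    term (substPower a f) (substPower a g) k j ≈ 0#
  term-nonMultiple a f g k j j≢la = trans (*-congʳ (coeff-substPower-nonMultiple a f j j≢la)) (zeroˡ _)

  term-multiple : ∀ a .{{_ : NonZero a}} f g k l →
    term (substPower a f) (substPower a g) (k ℤ.* + a) (l ℤ.* + a) ≈ term f g k l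
  term-multiple a f g k l = *-cong (coeff-substPower-multiple a f l) (trans
    (reflexive (≡.cong (coeff (substPower a g)) (distribʳ-- k l (+ a))))
    (coeff-substPower-multiple a g (k ℤ.- l)))

  productLength-substPower : ∀ a .{{_ : NonZero a}} f g k →
    productLength (substPower a f) (substPower a g) (k ℤ.* + a) ≡ suc (∣ k ℤ.- (bound f ℤ.+ bound g) ∣ ℕ.* a)
  productLength-substPower a f g k = ≡.cong suc (≡.trans
    (≡.cong ∣_∣ (factor k (bound f) (bound g) (+ a))) (ℤ.abs-* (k ℤ.- (bound f ℤ.+ bound g)) (+ a)))
    where
    factor : ∀ k b d a → k ℤ.* a ℤ.- (b ℤ.* a ℤ.+ d ℤ.* a) ≡ (k ℤ.- (b ℤ.+ d)) ℤ.* a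
    factor = ℤSolver.solve-∀

  -- At a multiple of `a`, bounds and window scale by `a` and only multiples of `a` contribute. In
  -- any other degree i all terms vanish, since j and i - j cannot both be multiples of `a`.
  substPower-* : ∀ a .{{_ : NonZero a}} f g → substPower a (f *ᴸ g) ≈ᴸ substPower a f *ᴸ substPower a g
  substPower-* a f g i with multipleOf? a i
  ... | multiple k ≡.refl = begin
    coeff (substPower a (f *ᴸ g)) (k ℤ.* + a)
      ≈⟨ coeff-substPower-multiple a (f *ᴸ g) k ⟩
    coeff (f *ᴸ g) k
      ≡⟨ coeff-*-sumFrom f g k ⟩
    sumFrom (bound f) (suc n) (term f g k)
      ≈⟨ sumFrom-cong (term-multiple a f g k) (bound f) (suc n) ⟨
    sumFrom (bound f) (suc n) (λ l → term σf σg (k ℤ.* + a) (l ℤ.* + a))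
      ≈⟨ sumFrom-multiples a (term-nonMultiple a f g (k ℤ.* + a)) (bound f) n ⟨
    sumFrom (bound f ℤ.* + a) (suc (n ℕ.* a)) (term σf σg (k ℤ.* + a))
      ≡⟨ ≡.cong (λ m → sumFrom (bound f ℤ.* + a) m (term σf σg (k ℤ.* + a)))
           (productLength-substPower a f g k) ⟨
    sumFrom (bound σf) (productLength σf σg (k ℤ.* + a)) (term σf σg (k ℤ.* + a))
      ≡⟨ coeff-*-sumFrom σf σg (k ℤ.* + a) ⟨
    coeff (σf *ᴸ σg) (k ℤ.* + a) ∎
    where
    σf = substPower a f
    σg = substPower a g
    n = ∣ k ℤ.- (bound f ℤ.+ bound g) ∣
  ... | nonMultiple i≢ka = trans (coeff-substPower-nonMultiple a (f *ᴸ g) i i≢ka)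
    (sym (coeff-* (substPower a f) (substPower a g) i {0ℤ} {0} ((λ j _ → term≈0 j) , (λ j _ → term≈0 j))))
    where
    term≈0 : ∀ j → term (substPower a f) (substPower a g) i j ≈ 0#
    term≈0 j with multipleOf? a j | multipleOf? a (i ℤ.- j)
    ... | nonMultiple j≢ka | _ = term-nonMultiple a f g i j j≢ka
    ... | _ | nonMultiple i-j≢ka = trans (*-congˡ (coeff-substPower-nonMultiple a g (i ℤ.- j) i-j≢ka)) (zeroʳ _)
    ... | multiple k j≡ka | multiple l i-j≡la = contradiction
      (≡.trans (minus-multiple i (k ℤ.* + a) j (l ℤ.* + a) i-j≡la j≡ka)
               (≡.sym (ℤ.*-distribʳ-+ (+ a) l k)))
      (i≢ka (l ℤ.+ k))

-- Formulas evaluated in the direct limit and at a common index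

laurentRing : CommutativeRing c ℓ → RawRing (c ⊔ ℓ) ℓ
laurentRing R = record
  { Carrier = Laurent
  ; _≈_     = _≈ᴸ_
  ; _+_     = _+ᴸ_
  ; _*_     = _*ᴸ_
  ; -_      = -ᴸ_
  ; 0#      = 0ᴸ
  ; 1#      = 1ᴸ
  }
  where open LaurentSeries R

module PuiseuxProperties (R : CommutativeRing c ℓ) where
  open CommutativeRing R
  open LaurentSeries R
  open PuiseuxSeries R
  open LaurentProperties R
  open SubstPowerProperties R

  substPower-swap : ∀ a b c d .{{_ : NonZero a}} .{{_ : NonZero b}} .{{_ : NonZero c}} .{{_ : NonZero d}} f →
    b ℕ.* a ≡ d ℕ.* c → substPower a (substPower b f) ≈ᴸ substPower c (substPower d f)
  substPower-swap a b c d f ba≡dc i = trans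
    (substPower-∘ a b (b ℕ.* a) {{_}} {{_}} {{ℕ.m*n≢0 b a}} f ≡.refl i)
    (sym (substPower-∘ c d (b ℕ.* a) {{_}} {{_}} {{ℕ.m*n≢0 b a}} f ba≡dc i))

  ≈ᴾ-sym : ∀ {P Q} → P ≈ᴾ Q → Q ≈ᴾ P
  ≈ᴾ-sym record { a = a ; b = b ; commonIndex = ap≡bq ; imagesAgree = σf≈σg } = record
    { a = b ; b = a ; commonIndex = ≡.sym ap≡bq ; imagesAgree = λ i → sym (σf≈σg i) }

  -- Substituting by `c` in the first equation and by `b` in the second raises `g` to the same
  -- exponent bc in both.
  ≈ᴾ-trans : ∀ {P Q S} → P ≈ᴾ Q → Q ≈ᴾ S → P ≈ᴾ S
  ≈ᴾ-trans {mkPuiseux p f} {mkPuiseux q g} {mkPuiseux s h}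
    record { a = a ; b = b ; commonIndex = ap≡bq ; imagesAgree = f≈g }
    record { a = c ; b = d ; commonIndex = cq≡ds ; imagesAgree = g≈h } = record
    { a = a ℕ.* c ; b = d ℕ.* b
    ; a-nonZero = ℕ.m*n≢0 a c ; b-nonZero = ℕ.m*n≢0 d b
    ; commonIndex = index≡ a b c d ap≡bq cq≡ds
    ; imagesAgree = λ i → begin
        coeff (substPower (a ℕ.* c) {{ℕ.m*n≢0 a c}} f) i
          ≈⟨ substPower-∘ c a (a ℕ.* c) {{_}} {{_}} {{ℕ.m*n≢0 a c}} f ≡.refl i ⟨
        coeff (substPower c (substPower a f)) i
          ≈⟨ substPower-cong c (substPower a f) (substPower b g) f≈g i ⟩
        coeff (substPower c (substPower b g)) i
          ≈⟨ substPower-swap c b b c g (ℕ.*-comm b c) i ⟩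
        coeff (substPower b (substPower c g)) i
          ≈⟨ substPower-cong b (substPower c g) (substPower d h) g≈h i ⟩
        coeff (substPower b (substPower d h)) i
          ≈⟨ substPower-∘ b d (d ℕ.* b) {{_}} {{_}} {{ℕ.m*n≢0 d b}} h ≡.refl i ⟩
        coeff (substPower (d ℕ.* b) {{ℕ.m*n≢0 d b}} h) i ∎
    }
    where
    open import Relation.Binary.Reasoning.Setoid setoid
    index≡ : ∀ a b c d → a ℕ.* p ≡ b ℕ.* q → c ℕ.* q ≡ d ℕ.* s → a ℕ.* c ℕ.* p ≡ d ℕ.* b ℕ.* s
    index≡ a b c d ap≡bq cq≡ds = ≡.trans (s₁ a c p) (≡.trans (≡.cong (c ℕ.*_) ap≡bq)
      (≡.trans (s₂ c b q) (≡.trans (≡.cong (b ℕ.*_) cq≡ds) (s₃ b d s))))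
      where
      s₁ : ∀ a c p → a ℕ.* c ℕ.* p ≡ c ℕ.* (a ℕ.* p)
      s₁ = ℕSolver.solve-∀
      s₂ : ∀ c b q → c ℕ.* (b ℕ.* q) ≡ b ℕ.* (c ℕ.* q)
      s₂ = ℕSolver.solve-∀
      s₃ : ∀ b d s → b ℕ.* (d ℕ.* s) ≡ d ℕ.* b ℕ.* s
      s₃ = ℕSolver.solve-∀

  -- The inclusion of R((t^{1/M})) into the direct limit.
  module _ (M : ℕ) .{{_ : NonZero M}} where

    ≈ᴸ⇒≈ᴾ : ∀ F G → F ≈ᴸ G → mkPuiseux M F ≈ᴾ mkPuiseux M G
    ≈ᴸ⇒≈ᴾ F G F≈G = record
      { a = 1 ; b = 1 ; commonIndex = ≡.refl ; imagesAgree = substPower-cong 1 F G F≈G }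

    -- Cancelling `M` from the index equation forces a = b, and `substPower a` is injective.
    ≈ᴾ⇒≈ᴸ : ∀ F G → mkPuiseux M F ≈ᴾ mkPuiseux M G → F ≈ᴸ G
    ≈ᴾ⇒≈ᴸ F G record { a = a ; b = b ; commonIndex = aM≡bM ; imagesAgree = σF≈σG }
      = cancel a b (ℕ.*-cancelʳ-≡ a b M aM≡bM) σF≈σG
      where
      cancel : ∀ a b .{{_ : NonZero a}} .{{_ : NonZero b}} → a ≡ b →
        substPower a F ≈ᴸ substPower b G → F ≈ᴸ G
      cancel a@(suc _) .a ≡.refl = substPower-injective a F G

    ≈ᴾ-mk : ∀ n m .{{_ : NonZero n}} .{{_ : NonZero m}} f → m ℕ.* n ≡ M →
      mkPuiseux n f ≈ᴾ mkPuiseux M (substPower m f)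
    ≈ᴾ-mk n m f mn≡M = record
      { a = m ; b = 1 ; commonIndex = ≡.trans mn≡M (≡.sym (ℕ.*-identityˡ M))
      ; imagesAgree = λ i → sym (substPower-∘ 1 m m f (≡.sym (ℕ.*-identityʳ m)) i) }

    -- From am = bM and cn = dM follows (ac)(mn) = (bdM)M. So the lifted result, which has index mn,
    -- is substituted by ac, and `F ∙ G` by e = bdM.
    ≈ᴾ-liftOp₂ : ∀ (_∙_ : Laurent → Laurent → Laurent) →
      (∀ f f′ g g′ → f ≈ᴸ f′ → g ≈ᴸ g′ → (f ∙ g) ≈ᴸ (f′ ∙ g′)) →
      (∀ a .{{_ : NonZero a}} f g → substPower a (f ∙ g) ≈ᴸ (substPower a f ∙ substPower a g)) →
      ∀ P Q F G → P ≈ᴾ mkPuiseux M F → Q ≈ᴾ mkPuiseux M G → liftOp₂ _∙_ P Q ≈ᴾ mkPuiseux M (F ∙ G)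
    ≈ᴾ-liftOp₂ _∙_ ∙-cong substPower-∙ (mkPuiseux m f) (mkPuiseux n g) F G
      record { a = a ; b = b ; b-nonZero = b≢0 ; commonIndex = am≡bM ; imagesAgree = f≈F }
      record { a = c ; b = d ; commonIndex = cn≡dM ; imagesAgree = g≈G } = record
      { a = a ℕ.* c ; b = b ℕ.* (d ℕ.* M)
      ; a-nonZero = ac≢0
      ; b-nonZero = bdM≢0
      ; commonIndex = ≡.trans (s₁ a c m n) (≡.trans (≡.cong₂ ℕ._*_ am≡bM cn≡dM) (s₂ b d M))
      ; imagesAgree = λ i → trans (substPower-∙ (a ℕ.* c) {{ac≢0}} (substPower n f) (substPower m g) i) (trans
          (∙-cong _ (substPower e {{bdM≢0}} F) _ (substPower e {{bdM≢0}} G)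
            (common a b c n f F f≈F (≡.cong (b ℕ.*_) cn≡dM))
            (λ i → trans (substPower-swap (a ℕ.* c) m (c ℕ.* a) m {{ac≢0}} {{_}} {{ℕ.m*n≢0 c a}} {{_}} g
                            (≡.cong (m ℕ.*_) (ℕ.*-comm a c)) i)
                         (common c d a m g G g≈G (≡.trans (≡.cong (d ℕ.*_) am≡bM) (s₃ d b M)) i))
            i)
          (sym (substPower-∙ e {{bdM≢0}} F G i)))
      }
      where
      e = b ℕ.* (d ℕ.* M)
      .ac≢0 : NonZero (a ℕ.* c)
      ac≢0 = ℕ.m*n≢0 a c
      .bdM≢0 : NonZero e
      bdM≢0 = ℕ.m*n≢0 b (d ℕ.* M) {{b≢0}} {{ℕ.m*n≢0 d M}}
      s₁ : ∀ a c m n → a ℕ.* c ℕ.* (m ℕ.* n) ≡ a ℕ.* m ℕ.* (c ℕ.* n)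
      s₁ = ℕSolver.solve-∀
      s₂ : ∀ b d M → b ℕ.* M ℕ.* (d ℕ.* M) ≡ b ℕ.* (d ℕ.* M) ℕ.* M
      s₂ = ℕSolver.solve-∀
      s₃ : ∀ d b M → d ℕ.* (b ℕ.* M) ≡ b ℕ.* (d ℕ.* M)
      s₃ = ℕSolver.solve-∀
      s₄ : ∀ a c n → n ℕ.* (a ℕ.* c) ≡ a ℕ.* (c ℕ.* n)
      s₄ = ℕSolver.solve-∀
      common : ∀ a b c n .{{_ : NonZero a}} .{{_ : NonZero b}} .{{_ : NonZero c}} .{{_ : NonZero n}} f F →
        substPower a f ≈ᴸ substPower b F → b ℕ.* (c ℕ.* n) ≡ e →
        substPower (a ℕ.* c) {{ℕ.m*n≢0 a c}} (substPower n f) ≈ᴸ substPower e {{bdM≢0}} F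
      common a b c n f F σf≈σF bcn≡e i = trans
        (substPower-swap (a ℕ.* c) n (c ℕ.* n) a {{ℕ.m*n≢0 a c}} {{_}} {{ℕ.m*n≢0 c n}} {{_}} f (s₄ a c n) i)
        (trans (substPower-cong (c ℕ.* n) {{ℕ.m*n≢0 c n}} (substPower a f) (substPower b F) σf≈σF i)
               (substPower-∘ (c ℕ.* n) b e {{ℕ.m*n≢0 c n}} {{_}} {{bdM≢0}} F (≡.sym bcn≡e) i))

    private
      module P = Semantics (PuiseuxSeries.puiseuxRing R)
      module L = Semantics (laurentRing R)

    ⟦⟧-mk : ∀ {k} (ρ : Vec Puiseux k) (ρ′ : Vec Laurent k) →
      (∀ i → lookup ρ i ≈ᴾ mkPuiseux M (lookup ρ′ i)) →
      ∀ t → P.⟦ t ⟧ ρ ≈ᴾ mkPuiseux M (L.⟦ t ⟧ ρ′)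
    ⟦⟧-mk ρ ρ′ ρ≈ρ′ (var i) = ρ≈ρ′ i
    -- The constants have index 1, so `M` is the factor that brings them to index `M`.
    ⟦⟧-mk ρ ρ′ ρ≈ρ′ 𝟎 = record
      { a = M ; b = 1 ; commonIndex = ℕ.*-comm M 1
      ; imagesAgree = λ i → trans (substPower-0ᴸ M i) (sym (substPower-0ᴸ 1 i)) }
    ⟦⟧-mk ρ ρ′ ρ≈ρ′ 𝟏 = record
      { a = M ; b = 1 ; commonIndex = ℕ.*-comm M 1
      ; imagesAgree = λ i → trans (substPower-1ᴸ M i) (sym (substPower-1ᴸ 1 i)) }
    ⟦⟧-mk ρ ρ′ ρ≈ρ′ (s ⊕ t) = ≈ᴾ-liftOp₂ _+ᴸ_ (λ _ _ _ _ f≈f′ g≈g′ i → +-cong (f≈f′ i) (g≈g′ i)) substPower-+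
      (P.⟦ s ⟧ ρ) (P.⟦ t ⟧ ρ) (L.⟦ s ⟧ ρ′) (L.⟦ t ⟧ ρ′) (⟦⟧-mk ρ ρ′ ρ≈ρ′ s) (⟦⟧-mk ρ ρ′ ρ≈ρ′ t)
    ⟦⟧-mk ρ ρ′ ρ≈ρ′ (s ⊗ t) = ≈ᴾ-liftOp₂ _*ᴸ_ *ᴸ-cong substPower-*
      (P.⟦ s ⟧ ρ) (P.⟦ t ⟧ ρ) (L.⟦ s ⟧ ρ′) (L.⟦ t ⟧ ρ′) (⟦⟧-mk ρ ρ′ ρ≈ρ′ s) (⟦⟧-mk ρ ρ′ ρ≈ρ′ t)
    ⟦⟧-mk ρ ρ′ ρ≈ρ′ (⊝ t) with P.⟦ t ⟧ ρ | L.⟦ t ⟧ ρ′ | ⟦⟧-mk ρ ρ′ ρ≈ρ′ t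
    ... | mkPuiseux m f | F | record { a = a ; b = b ; commonIndex = am≡bM ; imagesAgree = f≈F } = record
      { a = a ; b = b ; commonIndex = am≡bM ; imagesAgree = λ i → trans (substPower-neg a f i)
          (trans (-‿cong (f≈F i)) (sym (substPower-neg b F i))) }

    -- An embedding preserves and reflects quantifier-free formulas; negation makes the induction
    -- carry both directions.
    ⊨qf-mk : ∀ {k} (ρ : Vec Puiseux k) (ρ′ : Vec Laurent k) →
      (∀ i → lookup ρ i ≈ᴾ mkPuiseux M (lookup ρ′ i)) →
      ∀ φ → Semantics._⊨qf_ (PuiseuxSeries.puiseuxRing R) ρ φ ⇔ Semantics._⊨qf_ (laurentRing R) ρ′ φ
    ⊨qf-mk ρ ρ′ ρ≈ρ′ (s ≐ t) = mk⇔
      (λ s≈t → ≈ᴾ⇒≈ᴸ (L.⟦ s ⟧ ρ′) (L.⟦ t ⟧ ρ′) (≈ᴾ-trans (≈ᴾ-sym s≈s′) (≈ᴾ-trans s≈t t≈t′)))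
      (λ s′≈t′ → ≈ᴾ-trans s≈s′ (≈ᴾ-trans (≈ᴸ⇒≈ᴾ (L.⟦ s ⟧ ρ′) (L.⟦ t ⟧ ρ′) s′≈t′) (≈ᴾ-sym t≈t′)))
      where
      s≈s′ = ⟦⟧-mk ρ ρ′ ρ≈ρ′ s
      t≈t′ = ⟦⟧-mk ρ ρ′ ρ≈ρ′ t
    ⊨qf-mk ρ ρ′ ρ≈ρ′ (¬′ φ)   = ¬-cong-⇔ (⊨qf-mk ρ ρ′ ρ≈ρ′ φ)
    ⊨qf-mk ρ ρ′ ρ≈ρ′ (φ ∧′ ψ) = ⊨qf-mk ρ ρ′ ρ≈ρ′ φ ×-⇔ ⊨qf-mk ρ ρ′ ρ≈ρ′ ψ
    ⊨qf-mk ρ ρ′ ρ≈ρ′ (φ ∨′ ψ) = ⊨qf-mk ρ ρ′ ρ≈ρ′ φ ⊎-⇔ ⊨qf-mk ρ ρ′ ρ≈ρ′ ψ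

-- The equation y = w(x) D(y) over Laurent series

i<suc[j]⇒i≤j : ∀ {i j} → i ℤ.< ℤ.suc j → i ℤ.≤ j
i<suc[j]⇒i≤j {i} {j} i<1+j = ≡.subst (i ℤ.≤_) (ℤ.pred-suc j) (ℤ.i<j⇒i≤pred[j] i<1+j)

nj<j : ∀ {n j} → 1 ℕ.< n → j ℤ.< 0ℤ → + n ℤ.* j ℤ.< j
nj<j {n} {j} 1<n j<0 = ≡.subst (+ n ℤ.* j ℤ.<_) (ℤ.*-identityˡ j)
  (ℤ.*-monoʳ-<-neg j {{ℤ.negative j<0}} (ℤ.+<+ 1<n))

module _ (A : RawRing c ℓ) where
  open RawRing A
  open RawSemiringDefinitions rawSemiring using (_^_)

  -- This is w, and `denominator` is D.
  frobeniusDefect : ℕ → Carrier → Carrier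
  frobeniusDefect e x = x ^ e + - x

  denominator : ℕ → Carrier → Carrier
  denominator e y = 1# + y + - (y ^ e)

  record Solves (e : ℕ) (x y : Carrier) : Set ℓ where
    constructor solves
    field
      equation : y ≈ frobeniusDefect e x * denominator e y

module PowerSeriesEquation (R : CommutativeRing c ℓ) where
  open CommutativeRing R
  open LaurentSeries R
  open LaurentProperties R
  open VanishesBelow
  open import Algebra.Properties.Ring ring using (-0#≈0#; -‿involutive)
  open import Algebra.Properties.Semiring.Exp semiring using (_^_)
  open RawSemiringDefinitions (RawRing.rawSemiring (laurentRing R)) using () renaming (_^_ to _^ᴸ_)
  open import Relation.Binary.Reasoning.Setoid setoid

  vanishes-mono : ∀ f {b c} → c ℤ.≤ b → VanishesBelow f b → VanishesBelow f c
  vanishes-mono f c≤b vf = vanishingBelow λ i i<c → coeff≈0 vf i (ℤ.<-≤-trans i<c c≤b)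

  0ᴸ-vanishes : ∀ b → VanishesBelow 0ᴸ b
  0ᴸ-vanishes b = vanishingBelow λ _ _ → refl

  1ᴸ-vanishes : VanishesBelow 1ᴸ 0ℤ
  1ᴸ-vanishes = vanishesBelow-bound 1ᴸ

  +-vanishes : ∀ f g {b} → VanishesBelow f b → VanishesBelow g b → VanishesBelow (f +ᴸ g) b
  +-vanishes f g vf vg = vanishingBelow λ i i<b →
    trans (+-cong (coeff≈0 vf i i<b) (coeff≈0 vg i i<b)) (+-identityˡ 0#)

  neg-vanishes : ∀ f {b} → VanishesBelow f b → VanishesBelow (-ᴸ f) b
  neg-vanishes f vf = vanishingBelow λ i i<b → trans (-‿cong (coeff≈0 vf i i<b)) -0#≈0#

  ^-vanishes : ∀ f n → VanishesBelow f 0ℤ → VanishesBelow (f ^ᴸ n) 0ℤ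
  ^-vanishes f zero    vf = 1ᴸ-vanishes
  ^-vanishes f (suc n) vf = *-vanishes f (f ^ᴸ n) vf (^-vanishes f n vf)

  coeff-^-0 : ∀ f n → VanishesBelow f 0ℤ → coeff (f ^ᴸ n) 0ℤ ≈ coeff f 0ℤ ^ n
  coeff-^-0 f zero    vf = refl
  coeff-^-0 f (suc n) vf = trans (coeff-*-lead f (f ^ᴸ n) vf (^-vanishes f n vf)) (*-congˡ (coeff-^-0 f n vf))

  denominator-vanishes : ∀ e f → VanishesBelow f 0ℤ → VanishesBelow (denominator (laurentRing R) e f) 0ℤ
  denominator-vanishes e f vf = +-vanishes (1ᴸ +ᴸ f) (-ᴸ (f ^ᴸ e))
    (+-vanishes 1ᴸ f 1ᴸ-vanishes vf) (neg-vanishes (f ^ᴸ e) (^-vanishes f e vf))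

  -- This is v(f - g) ≥ b, the t-adic closeness in which the fixed point is approximated.
  record AgreeBelow (f g : Laurent) (b : ℤ) : Set ℓ where
    constructor agreeingBelow
    field
      coeff≈ : ∀ i → i ℤ.< b → coeff f i ≈ coeff g i

  open AgreeBelow

  -- For j < b the left factor vanishes; for j ≥ b the right factor is read at i - j < k. The gain
  -- of `b` is what makes multiplication by w(x) contracting.
  *-agreeʳ : ∀ h f g {b k} → VanishesBelow h b → AgreeBelow f g k → AgreeBelow (h *ᴸ f) (h *ᴸ g) (b ℤ.+ k)
  *-agreeʳ h f g {b} vh f~g = agreeingBelow λ i i<b+k → coeff-*-cong h f h g i λ j →
    case i i<b+k j
    where
    case : ∀ i → i ℤ.< b ℤ.+ _ → ∀ j → term h f i j ≈ term h g i j
    case i i<b+k j with j ℤ.<? b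
    ... | yes j<b = trans (term-zeroˡ f i vh j j<b) (sym (term-zeroˡ g i vh j j<b))
    ... | no j≮b  = *-congˡ (coeff≈ f~g (i ℤ.- j) (i<b+c⇒i-k<c i<b+k (ℤ.≮⇒≥ j≮b)))

  *-agreeˡ : ∀ h f g {k} → VanishesBelow h 0ℤ → AgreeBelow f g k → AgreeBelow (f *ᴸ h) (g *ᴸ h) k
  *-agreeˡ h f g {k} vh f~g = agreeingBelow λ i i<k → coeff-*-cong f h g h i λ j → case i i<k j
    where
    case : ∀ i → i ℤ.< k → ∀ j → term f h i j ≈ term g h i j
    case i i<k j with j ℤ.<? k
    ... | yes j<k = *-congʳ (coeff≈ f~g j j<k)
    ... | no j≮k  = trans (term-zeroʳ f i vh j i-j<0) (sym (term-zeroʳ g i vh j i-j<0))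
      where
      i-j<0 = i<b+c⇒i-k<c (≡.subst (i ℤ.<_) (≡.sym (ℤ.+-identityʳ k)) i<k) (ℤ.≮⇒≥ j≮k)

  agree-trans : ∀ {f g h b} → AgreeBelow f g b → AgreeBelow g h b → AgreeBelow f h b
  agree-trans f~g g~h = agreeingBelow λ i i<b → trans (coeff≈ f~g i i<b) (coeff≈ g~h i i<b)

  -- The factors are exchanged in two moves: f · fⁿ becomes f · gⁿ, which becomes g · gⁿ.
  ^-agree : ∀ f g {k} n → VanishesBelow f 0ℤ → VanishesBelow g 0ℤ → AgreeBelow f g k →
    AgreeBelow (f ^ᴸ n) (g ^ᴸ n) k
  ^-agree f g zero vf vg f~g = agreeingBelow λ _ _ → refl
  ^-agree f g {k} (suc n) vf vg f~g = agree-trans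
    (≡.subst (AgreeBelow (f *ᴸ (f ^ᴸ n)) (f *ᴸ (g ^ᴸ n))) (ℤ.+-identityˡ k) (*-agreeʳ f (f ^ᴸ n) (g ^ᴸ n) vf (^-agree f g n vf vg f~g)))
    (*-agreeˡ (g ^ᴸ n) f g (^-vanishes g n vg) f~g)

  denominator-agree : ∀ e f g {k} → VanishesBelow f 0ℤ → VanishesBelow g 0ℤ → AgreeBelow f g k →
    AgreeBelow (denominator (laurentRing R) e f) (denominator (laurentRing R) e g) k
  denominator-agree e f g vf vg f~g = agreeingBelow λ i i<k →
    +-cong (+-congˡ (coeff≈ f~g i i<k)) (-‿cong (coeff≈ (^-agree f g e vf vg f~g) i i<k))

  -- Banach's fixed point theorem for the t-adic metric, applied at one fixed index, where power
  -- series are complete.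
  module Contraction (Φ : Laurent → Laurent)
    (Φ-vanishes : ∀ f → VanishesBelow f 0ℤ → VanishesBelow (Φ f) 0ℤ)
    (Φ-contracts : ∀ f g {k} → VanishesBelow f 0ℤ → VanishesBelow g 0ℤ →
      AgreeBelow f g (+ k) → AgreeBelow (Φ f) (Φ g) (+ suc k)) where

    iterate : ℕ → Laurent
    iterate zero    = 0ᴸ
    iterate (suc n) = Φ (iterate n)

    iterate-vanishes : ∀ n → VanishesBelow (iterate n) 0ℤ
    iterate-vanishes zero    = 0ᴸ-vanishes 0ℤ
    iterate-vanishes (suc n) = Φ-vanishes (iterate n) (iterate-vanishes n)

    iterate-agree : ∀ n → AgreeBelow (iterate n) (iterate (suc n)) (+ n)
    iterate-agree zero    = agreeingBelow λ i i<0 → sym (coeff≈0 (iterate-vanishes 1) i i<0)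
    iterate-agree (suc n) = Φ-contracts (iterate n) (iterate (suc n)) (iterate-vanishes n) (iterate-vanishes (suc n)) (iterate-agree n)

    iterate-stable : ∀ n k d → k ℕ.< n → coeff (iterate n) (+ k) ≈ coeff (iterate (d ℕ.+ n)) (+ k)
    iterate-stable n k zero    k<n = refl
    iterate-stable n k (suc d) k<n = trans (iterate-stable n k d k<n)
      (coeff≈ (iterate-agree (d ℕ.+ n)) (+ k) (ℤ.+<+ (ℕ.<-≤-trans k<n (ℕ.m≤n+m n d))))

    -- The coefficient of degree `k` no longer changes from `iterate (suc k)` on, so it is read off
    -- there.
    fixedPoint : Laurent
    fixedPoint = record { coeff = limit ; bound = 0ℤ ; vanishes = limit-vanishes }
      where
      limit : ℤ → Carrier
      limit (+ k)    = coeff (iterate (suc k)) (+ k)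
      limit -[1+ _ ] = 0#

      limit-vanishes : ∀ i → i ℤ.< 0ℤ → limit i ≈ 0#
      limit-vanishes (+ _)    (ℤ.+<+ ())
      limit-vanishes -[1+ _ ] _ = refl

    fixedPoint-vanishes : VanishesBelow fixedPoint 0ℤ
    fixedPoint-vanishes = vanishesBelow-bound fixedPoint

    fixedPoint-agree : ∀ n → AgreeBelow fixedPoint (iterate n) (+ n)
    fixedPoint-agree n = agreeingBelow agree
      where
      agree : ∀ i → i ℤ.< + n → coeff fixedPoint i ≈ coeff (iterate n) i
      agree -[1+ k ] _ = sym (coeff≈0 (iterate-vanishes n) -[1+ k ] ℤ.-<+)
      agree (+ k) (ℤ.+<+ k<n) = trans (iterate-stable (suc k) k (n ℕ.∸ suc k) (ℕ.n<1+n k))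
        (reflexive (≡.cong (λ m → coeff (iterate m) (+ k)) (ℕ.m∸n+n≡m k<n)))

    fixedPoint-fixed : fixedPoint ≈ᴸ Φ fixedPoint
    -- In degree i, with n = |i|, both sides agree with `iterate (suc n)`, which is `Φ (iterate n)`.
    fixedPoint-fixed i = trans
      (coeff≈ (fixedPoint-agree (suc n)) i i<1+n)
      (sym (coeff≈ (Φ-contracts fixedPoint (iterate n) fixedPoint-vanishes (iterate-vanishes n) (fixedPoint-agree n)) i i<1+n))
      where
      n = ∣ i ∣
      i<1+n : i ℤ.< + suc n
      i<1+n = ℤ.≤-<-trans (i≤∣i∣ i) (ℤ.+<+ (ℕ.n<1+n n))

  module _ {e} (a^e≈a : ∀ a → a ^ e ≈ a) where

    frobeniusDefect-vanishes : ∀ f → VanishesBelow f 0ℤ → VanishesBelow (frobeniusDefect (laurentRing R) e f) (+ 1)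
    frobeniusDefect-vanishes f vf = vanishingBelow w≈0
      where
      w = frobeniusDefect (laurentRing R) e f
      w≈0 : ∀ i → i ℤ.< + 1 → coeff w i ≈ 0#
      w≈0 -[1+ n ] _ = coeff≈0 (+-vanishes (f ^ᴸ e) (-ᴸ f) (^-vanishes f e vf) (neg-vanishes f vf)) -[1+ n ] ℤ.-<+
      w≈0 (+ zero) _ = begin
        coeff (f ^ᴸ e) 0ℤ + - coeff f 0ℤ   ≈⟨ +-congʳ (trans (coeff-^-0 f e vf) (a^e≈a _)) ⟩
        coeff f 0ℤ + - coeff f 0ℤ          ≈⟨ -‿inverseʳ _ ⟩
        0#                                 ∎
      w≈0 (+ suc _) (ℤ.+<+ (ℕ.s≤s ()))

    coeff-denominator-0 : ∀ f → VanishesBelow f 0ℤ → coeff (denominator (laurentRing R) e f) 0ℤ ≈ 1#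
    coeff-denominator-0 f vf = begin
      1# + a + - coeff (f ^ᴸ e) 0ℤ   ≈⟨ +-congˡ (-‿cong (trans (coeff-^-0 f e vf) (a^e≈a _))) ⟩
      1# + a + - a                   ≈⟨ +-assoc 1# a (- a) ⟩
      1# + (a + - a)                 ≈⟨ +-congˡ (-‿inverseʳ a) ⟩
      1# + 0#                        ≈⟨ +-identityʳ 1# ⟩
      1#                             ∎
      where a = coeff f 0ℤ

    solution : ∀ f → VanishesBelow f 0ℤ →
      ∃[ Y ] Solves (laurentRing R) e f Y
    solution f vf = fixedPoint , solves fixedPoint-fixed
      where
      w = frobeniusDefect (laurentRing R) e f
      D = denominator (laurentRing R) e
      vw = frobeniusDefect-vanishes f vf
      open Contraction (λ Y → w *ᴸ D Y)
        (λ Y vY → vanishes-mono (w *ᴸ D Y) (ℤ.+≤+ ℕ.z≤n) (*-vanishes w (D Y) vw (denominator-vanishes e Y vY)))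
        -- Since w vanishes below degree 1, multiplying by it gains one degree of agreement.
        (λ Y Z vY vZ Y~Z → *-agreeʳ w (D Y) (D Z) vw (denominator-agree e Y Z vY vZ Y~Z))

    module LeadingCoefficients
      (_≈0? : ∀ a → Dec (a ≈ 0#))
      (1≉0 : ¬ 1# ≈ 0#)
      (*-≉0 : ∀ a b → ¬ a ≈ 0# → ¬ b ≈ 0# → ¬ a * b ≈ 0#)
      (1<e : 1 ℕ.< e) where

      record HasOrder (f : Laurent) (b : ℤ) : Set ℓ where
        constructor hasOrder
        field
          below : VanishesBelow f b
          lead≉0 : ¬ coeff f b ≈ 0#

      open HasOrder

      order-* : ∀ f g {b c} → HasOrder f b → HasOrder g c → HasOrder (f *ᴸ g) (b ℤ.+ c)
      order-* f g (hasOrder vf f≉0) (hasOrder vg g≉0) =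
        hasOrder (*-vanishes f g vf vg) (*-≉0 _ _ f≉0 g≉0 ∘ trans (sym (coeff-*-lead f g vf vg)))

      order-^ : ∀ f {b} n → HasOrder f b → HasOrder (f ^ᴸ n) (+ n ℤ.* b)
      order-^ f {b} zero of =
        ≡.subst (HasOrder 1ᴸ) (≡.sym (ℤ.*-zeroˡ b)) (hasOrder 1ᴸ-vanishes 1≉0)
      order-^ f {b} (suc n) of =
        ≡.subst (HasOrder (f ^ᴸ suc n)) (≡.sym (ℤ.suc-* (+ n) b)) (order-* f (f ^ᴸ n) of (order-^ f n of))

      order-neg : ∀ f {b} → HasOrder f b → HasOrder (-ᴸ f) b
      order-neg f (hasOrder vf f≉0) = hasOrder (neg-vanishes f vf) λ -f≈0 →
        f≉0 (trans (sym (-‿involutive _)) (trans (-‿cong -f≈0) -0#≈0#))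
  
      order-+ˡ : ∀ f g {b c} → b ℤ.< c → HasOrder f b → VanishesBelow g c → HasOrder (f +ᴸ g) b
      order-+ˡ f g b<c (hasOrder vf f≉0) vg = hasOrder (+-vanishes f g vf (vanishes-mono g (ℤ.<⇒≤ b<c) vg))
        (f≉0 ∘ trans (sym (trans (+-congˡ (coeff≈0 vg _ b<c)) (+-identityʳ _))))

      order-+ʳ : ∀ f g {b c} → b ℤ.< c → VanishesBelow f c → HasOrder g b → HasOrder (f +ᴸ g) b
      order-+ʳ f g b<c vf (hasOrder vg g≉0) = hasOrder (+-vanishes f g (vanishes-mono f (ℤ.<⇒≤ b<c) vf) vg)
        (g≉0 ∘ trans (sym (trans (+-congʳ (coeff≈0 vf _ b<c)) (+-identityˡ _))))

      vanishes-suc : ∀ f {b} → VanishesBelow f b → coeff f b ≈ 0# → VanishesBelow f (ℤ.suc b)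
      vanishes-suc f {b} vf fb≈0 = vanishingBelow below-suc
        where
        below-suc : ∀ i → i ℤ.< ℤ.suc b → coeff f i ≈ 0#
        below-suc i i<1+b with i ℤ.≟ b
        ... | yes ≡.refl = fb≈0
        ... | no i≢b     = coeff≈0 vf i (ℤ.≤∧≢⇒< (i<suc[j]⇒i≤j i<1+b) i≢b)

      -- Only the finitely many degrees from `bound f` to -1 are searched, so deciding zero among
      -- the coefficients is enough.
      integral⊎negativeOrder : ∀ f → VanishesBelow f 0ℤ ⊎ (∃[ b ] b ℤ.< 0ℤ × HasOrder f b)
      integral⊎negativeOrder f with bound f | vanishesBelow-bound f
      ... | + n      | vf = inj₁ (vanishes-mono f (ℤ.+≤+ ℕ.z≤n) vf)
      ... | -[1+ n ] | vf = search (suc n) vf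
        where
        search : ∀ n → VanishesBelow f (ℤ.- + n) → VanishesBelow f 0ℤ ⊎ (∃[ b ] b ℤ.< 0ℤ × HasOrder f b)
        search zero    vf = inj₁ vf
        search (suc n) vf with coeff f -[1+ n ] ≈0?
        ... | no f≉0  = inj₂ (-[1+ n ] , ℤ.-<+ , hasOrder vf f≉0)
        ... | yes f≈0 = search n (≡.subst (VanishesBelow f) (ℤ.1-[1+n]≡-n n) (vanishes-suc f vf f≈0))

      solvable⇒integral : ∀ f Y → Solves (laurentRing R) e f Y →
        VanishesBelow f 0ℤ
      solvable⇒integral f Y (solves Y≈wD) with integral⊎negativeOrder f
      ... | inj₁ vf = vf
      ... | inj₂ (b , b<0 , of) = contradiction Y≈wD (Y≉wD (integral⊎negativeOrder Y))
        where
        w = frobeniusDefect (laurentRing R) e f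
        D = denominator (laurentRing R) e Y

        eb<0 : + e ℤ.* b ℤ.< 0ℤ
        eb<0 = ℤ.<-trans (nj<j 1<e b<0) b<0

        order-w : HasOrder w (+ e ℤ.* b)
        order-w = order-+ˡ (f ^ᴸ e) (-ᴸ f) (nj<j 1<e b<0) (order-^ f e of) (neg-vanishes f (below of))

        -- The nonzero leading coefficient of w D would have to equal a coefficient of `Y` in a
        -- degree where `Y` vanishes.
        tooSmall : ∀ d {h} → HasOrder D d → VanishesBelow Y h → + e ℤ.* b ℤ.+ d ℤ.< h → ¬ Y ≈ᴸ w *ᴸ D
        tooSmall d oD vY <h Y≈wD = lead≉0 (order-* w D order-w oD)
          (trans (sym (Y≈wD (+ e ℤ.* b ℤ.+ d))) (coeff≈0 vY _ <h))

        Y≉wD : VanishesBelow Y 0ℤ ⊎ (∃[ d ] d ℤ.< 0ℤ × HasOrder Y d) → ¬ Y ≈ᴸ w *ᴸ D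
        Y≉wD (inj₁ vY) = tooSmall 0ℤ
          (hasOrder (denominator-vanishes e Y vY) (1≉0 ∘ trans (sym (coeff-denominator-0 Y vY))))
          vY (ℤ.+-mono-<-≤ eb<0 ℤ.≤-refl)
        -- Here -yᵉ dominates 1 + y, so D has order e d, and e b + e d < 0 + d.
        Y≉wD (inj₂ (d , d<0 , oY)) = tooSmall (+ e ℤ.* d)
          (order-+ʳ (1ᴸ +ᴸ Y) (-ᴸ (Y ^ᴸ e)) (nj<j 1<e d<0)
            (+-vanishes 1ᴸ Y (vanishes-mono 1ᴸ (ℤ.<⇒≤ d<0) 1ᴸ-vanishes) (below oY))
            (order-neg (Y ^ᴸ e) (order-^ Y e oY)))
          (below oY)
          (≡.subst (+ e ℤ.* b ℤ.+ + e ℤ.* d ℤ.<_) (ℤ.+-identityˡ d) (ℤ.+-mono-< eb<0 (nj<j 1<e d<0)))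

-- The equation as a first-order formula

infixr 9 _^ᵀ_

_^ᵀ_ : ∀ {n} → Term n → ℕ → Term n
t ^ᵀ zero  = 𝟏
t ^ᵀ suc n = t ⊗ t ^ᵀ n

frobeniusDefect*denominator : ℕ → Term 2
frobeniusDefect*denominator e = (x ^ᵀ e ⊕ ⊝ x) ⊗ (𝟏 ⊕ y ⊕ ⊝ (y ^ᵀ e))
  where
  y x : Term 2
  -- The bound variable precedes the free one in the matrix.
  y = var zero
  x = var (suc zero)

equationFormula : ℕ → QFFormula 2
equationFormula e = var zero ≐ frobeniusDefect*denominator e

module _ (A : RawRing c ℓ) where
  open RawRing A
  open RawSemiringDefinitions rawSemiring using (_^_)
  open Semantics A

  -- `_^ᵀ_` follows the recursion of `_^_`, so the values agree up to `≡`, which can be substituted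
  -- in a raw ring.
  ⟦⟧-^ : ∀ {n} (t : Term n) ρ k → ⟦ t ^ᵀ k ⟧ ρ ≡ ⟦ t ⟧ ρ ^ k
  ⟦⟧-^ t ρ zero    = ≡.refl
  ⟦⟧-^ t ρ (suc k) = ≡.cong (⟦ t ⟧ ρ *_) (⟦⟧-^ t ρ k)

  ⟦⟧-frobeniusDefect*denominator : ∀ e x y →
    ⟦ frobeniusDefect*denominator e ⟧ (y ∷ x ∷ []) ≡ frobeniusDefect A e x * denominator A e y
  ⟦⟧-frobeniusDefect*denominator e x y = ≡.cong₂ (λ xᵉ yᵉ → (xᵉ + - x) * (1# + y + - yᵉ))
    (⟦⟧-^ (var (suc zero)) (y ∷ x ∷ []) e) (⟦⟧-^ (var zero) (y ∷ x ∷ []) e)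

  ⊨qf⇔solves : ∀ e x y → Semantics._⊨qf_ A (y ∷ x ∷ []) (equationFormula e) ⇔ Solves A e x y
  ⊨qf⇔solves e x y = mk⇔
    (λ y≈ → solves (≡.subst (y ≈_) (⟦⟧-frobeniusDefect*denominator e x y) y≈))
    (λ (solves y≈) → ≡.subst (y ≈_) (≡.sym (⟦⟧-frobeniusDefect*denominator e x y)) y≈)

-- The identity aᵉ = a in a finite field

module FiniteField {q} (F : HeytingField c ℓ₁ ℓ₂) (F↔q : HasCardinality (HeytingField.setoid F) q) where
  open HeytingField F
  open CommutativeRing (HeytingCommutativeRing.commutativeRing heytingCommutativeRing)
    using (ring; semiring)
  open import Algebra.Apartness.Properties.HeytingCommutativeRing heytingCommutativeRing
    using (1#0; x#0y#0→xy#0)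
  open import Algebra.Properties.Group (CommutativeRing.+-group (HeytingCommutativeRing.commutativeRing heytingCommutativeRing))
    using (x∙y⁻¹≈ε⇒x≈y; x≈y⇒x∙y⁻¹≈ε)
  open import Algebra.Properties.Ring ring using (x[y-z]≈xy-xz)
  open import Algebra.Properties.Semiring.Exp semiring using (_^_; ^-homo-*; ^-assocʳ; ^-congˡ; ^-congʳ)
  open import Relation.Binary.Reasoning.Setoid setoid
  open Inverse F↔q using (to; from; to-cong; from-cong; strictlyInverseʳ)

  to-injective : ∀ {x y} → to x ≡ to y → x ≈ y
  to-injective {x} {y} tx≡ty = begin
    x             ≈⟨ strictlyInverseʳ x ⟨
    from (to x)   ≈⟨ from-cong tx≡ty ⟩
    from (to y)   ≈⟨ strictlyInverseʳ y ⟩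
    y             ∎

  _≈0? : ∀ x → Dec (x ≈ 0#)
  x ≈0? = map′ to-injective to-cong (to x Fin.≟ to 0#)

  1≉0 : ¬ 1# ≈ 0#
  1≉0 1≈0 = proj₂ (tight 1# 0#) 1≈0 1#0

  -- By tightness, being nonzero gives the double negation of apartness from zero, which suffices
  -- because the goal is a negation.
  *-≉0 : ∀ x y → ¬ x ≈ 0# → ¬ y ≈ 0# → ¬ x * y ≈ 0#
  *-≉0 x y x≉0 y≉0 xy≈0 = x≉0 (proj₁ (tight x 0#) λ x#0 → y≉0 (proj₁ (tight y 0#) λ y#0 →
    proj₂ (tight (x * y) 0#) xy≈0 (x#0y#0→xy#0 x#0 y#0)))

  ^-≉0 : ∀ x n → ¬ x ≈ 0# → ¬ x ^ n ≈ 0#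
  ^-≉0 x zero    x≉0 = 1≉0
  ^-≉0 x (suc n) x≉0 = *-≉0 x (x ^ n) x≉0 (^-≉0 x n x≉0)

  *-cancelˡ : ∀ x y z → ¬ x ≈ 0# → x * y ≈ x * z → y ≈ z
  *-cancelˡ x y z x≉0 xy≈xz with (y - z) ≈0?
  ... | yes y-z≈0 = x∙y⁻¹≈ε⇒x≈y y z y-z≈0
  ... | no y-z≉0  = contradiction (trans (x[y-z]≈xy-xz x y z) (x≈y⇒x∙y⁻¹≈ε xy≈xz)) (*-≉0 x (y - z) x≉0 y-z≉0)

  1^n≈1 : ∀ n → 1# ^ n ≈ 1#
  1^n≈1 zero    = refl
  1^n≈1 (suc n) = trans (*-identityˡ _) (1^n≈1 n)

  -- Two of the q + 1 powers x⁰, …, x^q coincide, so the order of x is at most q and divides q!.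
  x^q!≈1 : ∀ x → ¬ x ≈ 0# → x ^ (q !) ≈ 1#
  x^q!≈1 x x≉0 with i , j , i<j , xⁱ≡xʲ ← Fin.pigeonhole (ℕ.n<1+n q) (λ i → to (x ^ toℕ i)) =
    power-of-period (toℕ j ℕ.∸ toℕ i) (ℕ.m<n⇒0<n∸m i<j)
      (ℕ.≤-trans (ℕ.m∸n≤m (toℕ j) (toℕ i)) (ℕ.s≤s⁻¹ (Fin.toℕ<n j)))
      (*-cancelˡ (x ^ toℕ i) _ 1# (^-≉0 x (toℕ i) x≉0) (begin
        x ^ toℕ i * x ^ (toℕ j ℕ.∸ toℕ i)   ≈⟨ ^-homo-* x (toℕ i) _ ⟨
        x ^ (toℕ i ℕ.+ (toℕ j ℕ.∸ toℕ i))   ≈⟨ ^-congʳ x (ℕ.m+[n∸m]≡n (ℕ.<⇒≤ i<j)) ⟩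
        x ^ toℕ j                           ≈⟨ to-injective xⁱ≡xʲ ⟨
        x ^ toℕ i                           ≈⟨ *-identityʳ _ ⟨
        x ^ toℕ i * 1#                      ∎))
    where
    power-of-period : ∀ d → 0 ℕ.< d → d ℕ.≤ q → x ^ d ≈ 1# → x ^ (q !) ≈ 1#
    power-of-period d@(suc d′) _ d≤q x^d≈1 with divides k q!≡kd ← ∣-trans (m∣m*n (d′ !)) (m≤n⇒m!∣n! d≤q) = begin
      x ^ (q !)       ≈⟨ ^-congʳ x (≡.trans q!≡kd (ℕ.*-comm k d)) ⟩
      x ^ (d ℕ.* k)   ≈⟨ ^-assocʳ x d k ⟨
      (x ^ d) ^ k     ≈⟨ ^-congˡ k x^d≈1 ⟩
      1# ^ k          ≈⟨ 1^n≈1 k ⟩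
      1#              ∎

  x^[1+q!]≈x : ∀ x → x ^ suc (q !) ≈ x
  x^[1+q!]≈x x with x ≈0?
  ... | yes x≈0 = trans (*-congʳ x≈0) (trans (zeroˡ _) (sym x≈0))
  ... | no x≉0  = trans (*-congˡ (x^q!≈1 x x≉0)) (*-identityʳ x)

-- Integrality and definability in the Puiseux series field

module PowerSeriesUnion (R : CommutativeRing c ℓ) where
  open CommutativeRing R
  open LaurentSeries R
  open PuiseuxSeries R
  open SubstPowerProperties R

  substPower-isPowerSeries : ∀ a .{{_ : NonZero a}} f → IsPowerSeries f → IsPowerSeries (substPower a f)
  substPower-isPowerSeries a f f∈O i i<0 with multipleOf? a i
  ... | multiple k ≡.refl  = trans (coeff-substPower-multiple a f k)
    (f∈O k (ℤ.*-cancelʳ-<-nonNeg (+ a) i<0))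
  ... | nonMultiple i≢ka = coeff-substPower-nonMultiple a f i i≢ka

  substPower-isPowerSeries⁻¹ : ∀ a .{{_ : NonZero a}} f → IsPowerSeries (substPower a f) → IsPowerSeries f
  substPower-isPowerSeries⁻¹ a@(suc _) f σf∈O k k<0 = trans (sym (coeff-substPower-multiple a f k))
    (σf∈O (k ℤ.* + a) (ℤ.*-monoʳ-<-pos (+ a) k<0))

  -- Integrality does not depend on the representative: substitution multiplies exponents by a
  -- positive integer, so their signs are preserved and reflected.
  inPowerSeriesUnion⇒isPowerSeries : ∀ x → InPowerSeriesUnion x → IsPowerSeries (series x)
  inPowerSeriesUnion⇒isPowerSeries (mkPuiseux m f)
    (mkPuiseux n g , g∈O , record { a = a ; b = b ; imagesAgree = σf≈σg }) =
    substPower-isPowerSeries⁻¹ a f λ i i<0 → trans (σf≈σg i) (substPower-isPowerSeries b g g∈O i i<0)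

  isPowerSeries⇒inPowerSeriesUnion : ∀ x → IsPowerSeries (series x) → InPowerSeriesUnion x
  isPowerSeries⇒inPowerSeriesUnion x x∈O = x , x∈O , record
    { a = 1 ; b = 1 ; commonIndex = ≡.refl ; imagesAgree = λ _ → refl }

module CommonIndex (R : CommutativeRing c ℓ) where
  open CommutativeRing R using (refl)
  open LaurentSeries R
  open PuiseuxSeries R
  open PuiseuxProperties R
  open PowerSeriesUnion R

  laurent⊨qf⇒puiseux⊨ : ∀ φ n .{{_ : NonZero n}} f Y →
    Semantics._⊨qf_ (laurentRing R) (Y ∷ f ∷ []) φ → Semantics._⊨_ (PuiseuxSeries.puiseuxRing R) (mkPuiseux n f ∷ []) (∃′ 1 φ)
  laurent⊨qf⇒puiseux⊨ φ n f Y ⊨φ = mkPuiseux n Y ∷ [] ,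
    Equivalence.from (⊨qf-mk n ((mkPuiseux n Y ∷ []) ++ (mkPuiseux n f ∷ [])) (Y ∷ f ∷ []) ρ≈ρ′ φ) ⊨φ
    where
    ρ≈ρ′ : ∀ i → lookup ((mkPuiseux n Y ∷ []) ++ (mkPuiseux n f ∷ [])) i ≈ᴾ mkPuiseux n (lookup (Y ∷ f ∷ []) i)
    ρ≈ρ′ zero       = ≈ᴸ⇒≈ᴾ n Y Y (λ _ → refl)
    ρ≈ρ′ (suc zero) = ≈ᴸ⇒≈ᴾ n f f (λ _ → refl)

  -- The witness may have an index `m` different from `n`. Both elements move to index m n, which
  -- replaces `f` by `substPower m f`. Matching `m` as a successor turns the irrelevant nonzeroness
  -- into a usable witness.
  puiseux⊨⇒laurent⊨qf : ∀ φ n .{{_ : NonZero n}} f → Semantics._⊨_ (PuiseuxSeries.puiseuxRing R) (mkPuiseux n f ∷ []) (∃′ 1 φ) →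
    Σ[ m ∈ ℕ ] Σ[ m≢0 ∈ NonZero m ] ∃[ Y ] Semantics._⊨qf_ (laurentRing R) (Y ∷ substPower m {{m≢0}} f ∷ []) φ
  puiseux⊨⇒laurent⊨qf φ n f (mkPuiseux m@(suc _) g ∷ [] , ⊨φ) = m , _ , substPower n g ,
    Equivalence.to (⊨qf-mk (m ℕ.* n) ((mkPuiseux m g ∷ []) ++ (mkPuiseux n f ∷ []))
      (substPower n g ∷ substPower m f ∷ []) ρ≈ρ′ φ) ⊨φ
    where
    instance
      mn≢0 : NonZero (m ℕ.* n)
      mn≢0 = ℕ.m*n≢0 m n
    ρ≈ρ′ : ∀ i → lookup ((mkPuiseux m g ∷ []) ++ (mkPuiseux n f ∷ [])) i ≈ᴾ
      mkPuiseux (m ℕ.* n) (lookup (substPower n g ∷ substPower m f ∷ []) i)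
    ρ≈ρ′ zero       = ≈ᴾ-mk (m ℕ.* n) m n g (ℕ.*-comm n m)
    ρ≈ρ′ (suc zero) = ≈ᴾ-mk (m ℕ.* n) n m f ≡.refl

  -- For a concrete φ, conversion checking would unfold the products inside ⟦_⟧.
  definable : ∀ φ →
    (∀ f → IsPowerSeries f → ∃[ Y ] Semantics._⊨qf_ (laurentRing R) (Y ∷ f ∷ []) φ) →
    (∀ f Y → Semantics._⊨qf_ (laurentRing R) (Y ∷ f ∷ []) φ → IsPowerSeries f) →
    ∃-∅-Definable (PuiseuxSeries.puiseuxRing R) (PuiseuxSeries.InPowerSeriesUnion R)
  definable φ integral⇒⊨φ ⊨φ⇒integral = ∃′ 1 φ , λ x → mk⇔ (to x) (from x)
    where
    to : ∀ x → InPowerSeriesUnion x → Semantics._⊨_ (PuiseuxSeries.puiseuxRing R) (x ∷ []) (∃′ 1 φ)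
    to x@(mkPuiseux n f) x∈𝒪 =
      let Y , ⊨φ = integral⇒⊨φ f (inPowerSeriesUnion⇒isPowerSeries x x∈𝒪)
      in laurent⊨qf⇒puiseux⊨ φ n f Y ⊨φ

    from : ∀ x → Semantics._⊨_ (PuiseuxSeries.puiseuxRing R) (x ∷ []) (∃′ 1 φ) → InPowerSeriesUnion x
    from x@(mkPuiseux n f) x⊨φ =
      let m , m≢0 , Y , ⊨φ = puiseux⊨⇒laurent⊨qf φ n f x⊨φ
      in isPowerSeries⇒inPowerSeriesUnion x (substPower-isPowerSeries⁻¹ m {{m≢0}} f
           (⊨φ⇒integral (substPower m {{m≢0}} f) Y ⊨φ))

module Definability (R : CommutativeRing c ℓ) where
  open CommutativeRing R
  open PowerSeriesEquation R
  open CommonIndex R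
  open LaurentProperties R using (vanishingBelow; module VanishesBelow)
  open import Algebra.Properties.Semiring.Exp semiring using (_^_)

  inPowerSeriesUnion-definable : ∀ e → (∀ a → a ^ e ≈ a) → (∀ a → Dec (a ≈ 0#)) → ¬ 1# ≈ 0# →
    (∀ a b → ¬ a ≈ 0# → ¬ b ≈ 0# → ¬ a * b ≈ 0#) → 1 ℕ.< e →
    ∃-∅-Definable (PuiseuxSeries.puiseuxRing R) (PuiseuxSeries.InPowerSeriesUnion R)
  inPowerSeriesUnion-definable e a^e≈a _≈0? 1≉0 *-≉0 1<e = definable (equationFormula e)
    (λ f f∈O → let Y , Y-solves = solution a^e≈a f (vanishingBelow f∈O)
               in Y , Equivalence.from (⊨qf⇔solves (laurentRing R) e f Y) Y-solves)
    (λ f Y ⊨φ → VanishesBelow.coeff≈0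
      (solvable⇒integral f Y (Equivalence.to (⊨qf⇔solves (laurentRing R) e f Y) ⊨φ)))
    where open LeadingCoefficients a^e≈a _≈0? 1≉0 *-≉0 1<e

theorem3p1 : ∀ {c ℓ₁ ℓ₂ : Level} (q : ℕ) → IsPrimePower q →
    (𝔽q : HeytingField c ℓ₁ ℓ₂) → HasCardinality (HeytingField.setoid 𝔽q) q →
    ∃-∅-Definable (K^Px 𝔽q) (𝒪^Px 𝔽q)
theorem3p1 q _ 𝔽q 𝔽q↔q = inPowerSeriesUnion-definable (suc (q !)) x^[1+q!]≈x _≈0? 1≉0 *-≉0 (ℕ.s≤s (ℕ.1≤n! q))
  where
  open FiniteField 𝔽q 𝔽q↔q
  open Definability (HeytingCommutativeRing.commutativeRing (HeytingField.heytingCommutativeRing 𝔽q))
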